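{- Let $S$ be the set of pure $O$-sequences of socle degree $3$, i.e. of the form $(1,h_1,h_2,h_3)$ with $h_3>0$. Then: (i) if $(1,h_1',h_2,h_3)\in S$ and $(1,h_1'',h_2,h_3)\in S$ and $h_1'\le h_1\le h_1''$, then $(1,h_1,h_2,h_3)\in S$; (ii) if $(1,h_1,h_2',h_3)\in S$ and $(1,h_1,h_2'',h_3)\in S$ and $h_2'\le h_2\le h_2''$, then $(1,h_1,h_2,h_3)\in S$; (iii) if $(1,h_1,h_2,h_3')\in S$ and $(1,h_1,h_2,h_3'')\in S$ and $h_3'\le h_3\le h_3''$, then $(1,h_1,h_2,h_3)\in S$.
   Context: A monomial order ideal is a finite nonempty set of monomials (in some polynomial ring) closed under taking divisors; it is pure if all its maximal monomials under divisibility have the same degree $e$, called the socle degree. A pure $O$-sequence is the vector $(h_0,\dots,h_e)$ where $h_i$ is the number of monomials of degree $i$ in a pure monomial order ideal of socle degree $e$. -}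

module Defs where

open import Data.Nat using (ℕ; suc; _≤_; _≟_)
open import Data.Fin using (Fin; toℕ)
open import Data.Vec using (Vec; []; _∷_; lookup)
import Data.Vec as Vec
open import Data.Vec.Relation.Binary.Pointwise.Inductive using (Pointwise)
open import Data.List using (List; length; filter)
open import Data.List.Membership.Propositional using (_∈_)
open import Data.List.Relation.Unary.Unique.Propositional using (Unique)
open import Data.Product using (Σ; ∃; _×_)
open import Relation.Binary.PropositionalEquality using (_≡_)

-- A monomial in n variables x_1..x_n, given by its exponent vector.
Mon : ℕ → Set
Mon n = Vec ℕ n

_∣ₘ_ : ∀ {n} → Mon n → Mon n → Set
d ∣ₘ m = Pointwise _≤_ d m

deg : ∀ {n} → Mon n → ℕ
deg m = Vec.sum m

IsOrderIdeal : ∀ {n} → List (Mon n) → Set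
IsOrderIdeal {n} L =
  Unique L × (∃ λ (m : Mon n) → m ∈ L) ×
  (∀ {m d : Mon n} → m ∈ L → d ∣ₘ m → d ∈ L)

IsMaximal : ∀ {n} → List (Mon n) → Mon n → Set
IsMaximal {n} L m = m ∈ L × (∀ {m' : Mon n} → m' ∈ L → m ∣ₘ m' → m' ≡ m)

IsPure : ∀ {n} → ℕ → List (Mon n) → Set
IsPure {n} e L = ∀ (m : Mon n) → IsMaximal L m → deg m ≡ e

count : ∀ {n} → List (Mon n) → ℕ → ℕ
count L i = length (filter (λ m → deg m ≟ i) L)

IsPureOSeq : (e : ℕ) → Vec ℕ (suc e) → Set
IsPureOSeq e h =
  Σ ℕ λ n → Σ (List (Mon n)) λ L →
    IsOrderIdeal L × IsPure e L × (∀ (i : Fin (suc e)) → lookup h i ≡ count L (toℕ i))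

S : ℕ → ℕ → ℕ → ℕ → Set
S h0 h1 h2 h3 = IsPureOSeq 3 (h0 ∷ h1 ∷ h2 ∷ h3 ∷ [])

{-# OPTIONS --safe #-}
-- Pass to the set T of cubics in the ideal, with c = #T, q quadrics dividing some member of T
-- and r variables occurring in T; then r ≤ q ≤ r(r+1)/2. The cases c ≤ q and c ≥ q behave
-- differently.
--
-- For c ≤ q, the triple (r, q, c) may be changed to any (r, q*, c*) with c ≤ c* ≤ q* ≤ q and r ≤ q*.
-- Remove the cubics one by one, the non-squarefree ones first, and at each stage refill:
-- lost variables by isolated cubics and otherwise by cubics contributing a single new quadric.
-- The resulting number of quadrics drops by at most one per step, or by two when a
-- squarefree xyz with three private quadrics goes; no squares are left at that stage, and
-- putting x²y in its place hits the skipped value. Moreover r can be raised while r < q by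
-- replacing one occurrence of a variable used twice by a fresh variable.
--
-- For c ≥ q, all cubics but at most q are redundant, so c can be lowered to q. As long as some
-- quadric is missing, x³ or x²y adds exactly one quadric, so q can be raised. To lower r, a
-- variable y is made minimal by swap compressions towards the other variables; then its
-- quadrics are traded for missing ones.
--
-- Each of the three intervals is swept from one of its ends by these moves.
module Submission where

open import Defs
open import Data.Nat using (ℕ; zero; suc; _+_; _*_; _∸_; _≤_; _<_; z≤n; s≤s; _≤?_)
import Data.Nat as ℕ
open import Data.Nat.Properties
open import Data.Nat.Induction using (<-wellFounded)
open import Data.Nat.Tactic.RingSolver using (solve-∀)
open import Data.Bool using (if_then_else_)
open import Data.Fin using (Fin; zero; suc)
import Data.Fin as Fin
import Data.Fin.Properties as Fin
open import Data.Fin.Permutation.Components using (transpose)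
open import Data.Vec using ([]; _∷_; lookup; replicate; tabulate)
import Data.Vec.Properties as Vec
open import Data.Vec.Relation.Binary.Pointwise.Inductive using ([]; _∷_)
import Data.Vec.Relation.Binary.Pointwise.Inductive as Pointwise
open import Data.List using (List; []; _∷_; _++_; length; map; filter; take; cartesianProduct; [_])
open import Data.List.Properties using (length-++; length-map; length-take; take++drop≡id; filter-++; filter-all; filter-none; filter-notAll; length-filter)
open import Data.List.Membership.Propositional using (_∈_; _∉_; find; lose)
open import Data.List.Membership.Propositional.Properties
import Data.List.Membership.DecPropositional as DecMembership
open import Data.List.Relation.Unary.Any using (here; there; any?)
open import Data.List.Relation.Unary.All using (All; []; _∷_; all?)
import Data.List.Relation.Unary.All as All
import Data.List.Relation.Unary.All.Properties as All
open import Data.List.Relation.Unary.AllPairs using (AllPairs; []; _∷_)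
import Data.List.Relation.Unary.AllPairs.Properties as AllPairs
open import Data.List.Relation.Unary.Unique.Propositional using (Unique)
import Data.List.Relation.Unary.Unique.Propositional.Properties as Unique
open import Data.List.Relation.Binary.Subset.Propositional using (_⊆_)
open import Data.Product using (Σ; ∃; _×_; _,_; proj₁; proj₂; uncurry)
open import Data.Sum using (_⊎_; inj₁; inj₂)
import Data.Sum as Sum
open import Data.Empty using (⊥; ⊥-elim)
open import Function using (_∘_; id)
open import Induction.WellFounded using (Acc; acc)
open import Relation.Nullary using (¬_; Dec; yes; no; ¬?)
open import Relation.Nullary.Decidable using (decidable-stable; does; dec-true; dec-false; _×-dec_)
open import Relation.Binary.Definitions using (DecidableEquality; tri<; tri≈; tri>)
open import Relation.Binary.PropositionalEquality hiding ([_])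

private variable
  A B : Set
  n : ℕ

-- Cardinalities of duplicate-free lists

nonempty : {xs : List A} → 0 < length xs → ∃ λ x → x ∈ xs
nonempty {xs = x ∷ _} _ = x , here refl

unique-∷ : ∀ {x : A} {xs} → x ∉ xs → Unique xs → Unique (x ∷ xs)
unique-∷ x∉ u = All.¬Any⇒All¬ _ x∉ ∷ u

length-⊆ : {xs ys : List A} → Unique xs → xs ⊆ ys → length xs ≤ length ys
length-⊆ {xs = []} _ _ = z≤n
length-⊆ {xs = x ∷ xs} {ys} (x∉ ∷ u) sub with ∈-∃++ (sub (here refl))
... | ys₁ , ys₂ , refl = begin
  suc (length xs)               ≤⟨ s≤s (length-⊆ u sub′) ⟩
  suc (length (ys₁ ++ ys₂))     ≡⟨ cong suc (length-++ ys₁) ⟩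
  suc (length ys₁ + length ys₂) ≡⟨ sym (+-suc (length ys₁) _) ⟩
  length ys₁ + suc (length ys₂) ≡⟨ sym (length-++ ys₁) ⟩
  length (ys₁ ++ x ∷ ys₂)       ∎
  where
  open ≤-Reasoning
  sub′ : xs ⊆ ys₁ ++ ys₂
  sub′ z∈ with ∈-++⁻ ys₁ (sub (there z∈))
  ... | inj₁ p = ∈-++⁺ˡ p
  ... | inj₂ (here refl) = ⊥-elim (All.All¬⇒¬Any x∉ z∈)
  ... | inj₂ (there p) = ∈-++⁺ʳ ys₁ p

length-≈ : {xs ys : List A} → Unique xs → Unique ys → xs ⊆ ys → ys ⊆ xs → length xs ≡ length ys
length-≈ ux uy p q = ≤-antisym (length-⊆ ux p) (length-⊆ uy q)

-- Unions of duplicate-free lists and their lengths.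

module Union {B : Set} (_≟_ : DecidableEquality B) where
  open DecMembership _≟_ using (_∈?_)

  -- Only what is new is put in front of `xs`, so the length grows by the number of entries of `ds`
  -- outside `xs`, and if there are none the result is literally `xs`.
  union : List B → List B → List B
  union ds xs = filter (λ d → ¬? (d ∈? xs)) ds ++ xs

  ∈-union⁺ˡ : ∀ {ds xs b} → b ∈ ds → b ∈ union ds xs
  ∈-union⁺ˡ {ds} {xs} {b} p with b ∈? xs
  ... | yes q = ∈-++⁺ʳ _ q
  ... | no ¬q = ∈-++⁺ˡ (∈-filter⁺ (λ d → ¬? (d ∈? xs)) p ¬q)

  ∈-union⁺ʳ : ∀ {ds xs b} → b ∈ xs → b ∈ union ds xs
  ∈-union⁺ʳ q = ∈-++⁺ʳ _ q

  ∈-union⁻ : ∀ {ds xs b} → b ∈ union ds xs → b ∈ ds ⊎ b ∈ xs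
  ∈-union⁻ {ds} {xs} p with ∈-++⁻ (filter (λ d → ¬? (d ∈? xs)) ds) p
  ... | inj₁ q = inj₁ (proj₁ (∈-filter⁻ (λ d → ¬? (d ∈? xs)) q))
  ... | inj₂ q = inj₂ q

  union-unique : ∀ {ds xs} → Unique ds → Unique xs → Unique (union ds xs)
  union-unique {ds} {xs} ud ux = Unique.++⁺ (Unique.filter⁺ _ ud) ux
    λ (p , q) → proj₂ (∈-filter⁻ (λ d → ¬? (d ∈? xs)) {xs = ds} p) q

  union-old : ∀ {ds xs} → ds ⊆ xs → union ds xs ≡ xs
  union-old {ds} {xs} sub = cong (_++ xs) (filter-none (λ d → ¬? (d ∈? xs)) {xs = ds} (All.tabulate λ p k → k (sub p)))

  length-union-new : ∀ {ds xs} → (∀ {d} → d ∈ ds → d ∉ xs) → length (union ds xs) ≡ length ds + length xs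
  length-union-new {ds} {xs} new = trans (cong (λ z → length (z ++ xs)) (filter-all (λ d → ¬? (d ∈? xs)) {xs = ds} (All.tabulate new))) (length-++ ds)

  length-union-≤ : ∀ ds xs → length (union ds xs) ≤ length ds + length xs
  length-union-≤ ds xs = ≤-trans (≤-reflexive (length-++ (filter (λ d → ¬? (d ∈? xs)) ds)))
    (+-monoˡ-≤ _ (length-filter _ ds))

  length-union-< : ∀ {ds xs b} → b ∈ ds → b ∉ xs → length xs < length (union ds xs)
  length-union-< {ds} {xs} p b∉ = subst (length xs <_) (sym (length-++ (filter (λ d → ¬? (d ∈? xs)) ds)))
    (+-monoˡ-≤ _ (∈-length (∈-filter⁺ (λ d → ¬? (d ∈? xs)) p b∉)))

  -- Meant for exact counts: `es` names the new elements of `ds`, and everything else in `ds` is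
  -- old.
  length-union-≡ : ∀ {ds xs} es → Unique ds → Unique xs → Unique es → es ⊆ ds → (∀ {e} → e ∈ es → e ∉ xs) →
    (∀ {d} → d ∈ ds → d ∈ es ⊎ d ∈ xs) → length (union ds xs) ≡ length es + length xs
  length-union-≡ {ds} {xs} es ud ux ue sub new cov =
    trans (length-≈ (union-unique ud ux) (Unique.++⁺ ue ux λ (p , q) → new p q) to from) (length-++ es)
    where
    to : union ds xs ⊆ es ++ xs
    to p with ∈-union⁻ {ds} p
    ... | inj₂ q = ∈-++⁺ʳ es q
    ... | inj₁ q with cov q
    ...   | inj₁ r = ∈-++⁺ˡ r
    ...   | inj₂ r = ∈-++⁺ʳ es r
    from : es ++ xs ⊆ union ds xs
    from p with ∈-++⁻ es p
    ... | inj₁ q = ∈-union⁺ˡ (sub q)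
    ... | inj₂ q = ∈-union⁺ʳ {ds} q

module Collect {A B : Set} (_≟_ : DecidableEquality B) (f : A → List B) where
  open Union _≟_ public

  collect : List A → List B
  collect [] = []
  collect (m ∷ T) = union (f m) (collect T)

  ∈-collect⁺ : ∀ {T m b} → m ∈ T → b ∈ f m → b ∈ collect T
  ∈-collect⁺ {m₁ ∷ T} (here refl) q = ∈-union⁺ˡ {ds = f m₁} q
  ∈-collect⁺ {m₁ ∷ T} (there p) q = ∈-union⁺ʳ {ds = f m₁} (∈-collect⁺ p q)

  ∈-collect⁻ : ∀ T {b} → b ∈ collect T → ∃ λ m → m ∈ T × b ∈ f m
  ∈-collect⁻ (m ∷ T) p with ∈-union⁻ {f m} p
  ... | inj₁ q = m , here refl , q
  ... | inj₂ q with ∈-collect⁻ T q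
  ...   | m′ , m∈ , b∈ = m′ , there m∈ , b∈

  collect-unique : (∀ m → Unique (f m)) → ∀ T → Unique (collect T)
  collect-unique u [] = []
  collect-unique u (m ∷ T) = union-unique (u m) (collect-unique u T)

  collect-⊆ : ∀ {T T′} → T ⊆ T′ → collect T ⊆ collect T′
  collect-⊆ {T} sub p with ∈-collect⁻ T p
  ... | m , m∈ , b∈ = ∈-collect⁺ (sub m∈) b∈

-- Monomials

infixr 7 _·_
_·_ : Fin n → Mon n → Mon n
zero · (a ∷ m) = suc a ∷ m
suc x · (a ∷ m) = a ∷ x · m

𝟙 : Mon n
𝟙 = replicate _ 0

_≟ₘ_ : DecidableEquality (Mon n)
_≟ₘ_ = Vec.≡-dec ℕ._≟_

deg-· : ∀ (x : Fin n) m → deg (x · m) ≡ suc (deg m)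
deg-· zero (a ∷ m) = refl
deg-· (suc x) (a ∷ m) = trans (cong (a +_) (deg-· x m)) (+-suc a _)

deg-𝟙 : ∀ n → deg (𝟙 {n}) ≡ 0
deg-𝟙 zero = refl
deg-𝟙 (suc n) = deg-𝟙 n

deg-0 : ∀ {n} (m : Mon n) → deg m ≡ 0 → m ≡ 𝟙
deg-0 [] _ = refl
deg-0 (zero ∷ m) p = cong (0 ∷_) (deg-0 m p)

deg-suc : ∀ {n k} (m : Mon n) → deg m ≡ suc k → ∃ λ x → ∃ λ m′ → m ≡ x · m′ × deg m′ ≡ k
deg-suc (suc a ∷ m) p = zero , a ∷ m , refl , suc-injective p
deg-suc (zero ∷ m) p with deg-suc m p
... | x , m′ , refl , q = suc x , 0 ∷ m′ , refl , q

·-cancel : ∀ (x : Fin n) {m m′} → x · m ≡ x · m′ → m ≡ m′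
·-cancel zero {a ∷ m} {b ∷ m′} refl = refl
·-cancel (suc x) {a ∷ m} {b ∷ m′} p =
  cong₂ _∷_ (Vec.∷-injectiveˡ p) (·-cancel x (Vec.∷-injectiveʳ p))

·-comm : ∀ (x y : Fin n) m → x · y · m ≡ y · x · m
·-comm zero zero (a ∷ m) = refl
·-comm zero (suc y) (a ∷ m) = refl
·-comm (suc x) zero (a ∷ m) = refl
·-comm (suc x) (suc y) (a ∷ m) = cong (a ∷_) (·-comm x y m)

-- Unique factorization, one variable at a time. The support and the divisors of a product are
-- computed from it.
·-diamond : ∀ (x y : Fin n) {m m′} → x · m ≡ y · m′ →
  (x ≡ y × m ≡ m′) ⊎ (∃ λ p → m ≡ y · p × m′ ≡ x · p)
·-diamond zero zero {a ∷ m} {.a ∷ .m} refl = inj₁ (refl , refl)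
·-diamond zero (suc y) {a ∷ m} {b ∷ m′} p with Vec.∷-injectiveˡ p | Vec.∷-injectiveʳ p
... | refl | refl = inj₂ (a ∷ m′ , refl , refl)
·-diamond (suc x) zero {a ∷ m} {b ∷ m′} p with Vec.∷-injectiveˡ p | Vec.∷-injectiveʳ p
... | refl | refl = inj₂ (b ∷ m , refl , refl)
·-diamond (suc x) (suc y) {a ∷ m} {b ∷ m′} p with Vec.∷-injectiveˡ p | ·-diamond x y {m} {m′} (Vec.∷-injectiveʳ p)
... | refl | inj₁ (refl , refl) = inj₁ (refl , refl)
... | refl | inj₂ (r , refl , refl) = inj₂ (a ∷ r , refl , refl)

supp : Mon n → List (Fin n)
supp [] = []
supp (zero ∷ m) = map suc (supp m)
supp (suc a ∷ m) = zero ∷ map suc (supp m)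

-- The shadow: m/x for each variable x dividing m. For a cubic these are its quadric divisors, as
-- many as it has distinct variables.
shad : Mon n → List (Mon n)
shad [] = []
shad (zero ∷ m) = map (0 ∷_) (shad m)
shad (suc a ∷ m) = (a ∷ m) ∷ map (suc a ∷_) (shad m)

length-shad : (m : Mon n) → length (shad m) ≡ length (supp m)
length-shad [] = refl
length-shad (zero ∷ m) = trans (length-map _ (shad m)) (trans (length-shad m) (sym (length-map _ (supp m))))
length-shad (suc a ∷ m) = cong suc (trans (length-map _ (shad m)) (trans (length-shad m) (sym (length-map _ (supp m)))))

length-supp-≤ : (m : Mon n) → length (supp m) ≤ deg m
length-supp-≤ [] = z≤n
length-supp-≤ (zero ∷ m) = ≤-trans (≤-reflexive (length-map _ (supp m))) (length-supp-≤ m)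
length-supp-≤ (suc a ∷ m) = s≤s (≤-trans (≤-trans (≤-reflexive (length-map _ (supp m))) (length-supp-≤ m)) (m≤n+m _ a))

supp-unique : (m : Mon n) → Unique (supp m)
supp-unique [] = []
supp-unique (zero ∷ m) = Unique.map⁺ Fin.suc-injective (supp-unique m)
supp-unique (suc a ∷ m) = unique-∷ (λ p → case (∈-map⁻ suc p)) (Unique.map⁺ Fin.suc-injective (supp-unique m))
  where case : ¬ ∃ λ y → y ∈ supp m × zero ≡ suc y
        case (_ , _ , ())

shad-unique : (m : Mon n) → Unique (shad m)
shad-unique [] = []
shad-unique (zero ∷ m) = Unique.map⁺ Vec.∷-injectiveʳ (shad-unique m)
shad-unique (suc a ∷ m) = unique-∷ (λ p → case (∈-map⁻ (suc a ∷_) p)) (Unique.map⁺ Vec.∷-injectiveʳ (shad-unique m))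
  where case : ¬ ∃ λ y → y ∈ shad m × a ∷ m ≡ suc a ∷ y
        case (_ , _ , ())

∈-supp⁺ : ∀ (x : Fin n) m → x ∈ supp (x · m)
∈-supp⁺ zero (a ∷ m) = here refl
∈-supp⁺ (suc x) (zero ∷ m) = ∈-map⁺ suc (∈-supp⁺ x m)
∈-supp⁺ (suc x) (suc a ∷ m) = there (∈-map⁺ suc (∈-supp⁺ x m))

∈-supp⁻ : ∀ {x : Fin n} m → x ∈ supp m → ∃ λ m′ → m ≡ x · m′
∈-supp⁻ (zero ∷ m) p with ∈-map⁻ suc p
... | y , y∈ , refl with ∈-supp⁻ m y∈
...   | m′ , refl = 0 ∷ m′ , refl
∈-supp⁻ (suc a ∷ m) (here refl) = a ∷ m , refl
∈-supp⁻ (suc a ∷ m) (there p) with ∈-map⁻ suc p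
... | y , y∈ , refl with ∈-supp⁻ m y∈
...   | m′ , refl = suc a ∷ m′ , refl

∈-shad⁺ : ∀ (x : Fin n) d → d ∈ shad (x · d)
∈-shad⁺ zero (a ∷ d) = here refl
∈-shad⁺ (suc x) (zero ∷ d) = ∈-map⁺ (0 ∷_) (∈-shad⁺ x d)
∈-shad⁺ (suc x) (suc a ∷ d) = there (∈-map⁺ (suc a ∷_) (∈-shad⁺ x d))

∈-shad⁻ : ∀ {d : Mon n} m → d ∈ shad m → ∃ λ x → m ≡ x · d
∈-shad⁻ (zero ∷ m) p with ∈-map⁻ (0 ∷_) p
... | d′ , d∈ , refl with ∈-shad⁻ m d∈
...   | x , refl = suc x , refl
∈-shad⁻ (suc a ∷ m) (here refl) = zero , refl
∈-shad⁻ (suc a ∷ m) (there p) with ∈-map⁻ (suc a ∷_) p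
... | d′ , d∈ , refl with ∈-shad⁻ m d∈
...   | x , refl = suc x , refl

∈-supp-·⁺ʳ : ∀ (x : Fin n) m {z} → z ∈ supp m → z ∈ supp (x · m)
∈-supp-·⁺ʳ x m {z} p with ∈-supp⁻ m p
... | m′ , refl = subst (λ w → z ∈ supp w) (·-comm z x m′) (∈-supp⁺ z (x · m′))

∈-supp-·⁻ : ∀ (x : Fin n) m {z} → z ∈ supp (x · m) → z ≡ x ⊎ z ∈ supp m
∈-supp-·⁻ x m {z} p with ∈-supp⁻ (x · m) p
... | m′ , eq with ·-diamond x z eq
...   | inj₁ (refl , _) = inj₁ refl
...   | inj₂ (r , refl , _) = inj₂ (∈-supp⁺ z r)

∈-shad-·⁻ : ∀ (x : Fin n) m {d} → d ∈ shad (x · m) → d ≡ m ⊎ ∃ λ d′ → d′ ∈ shad m × d ≡ x · d′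
∈-shad-·⁻ x m {d} p with ∈-shad⁻ (x · m) p
... | z , eq with ·-diamond x z eq
...   | inj₁ (_ , refl) = inj₁ refl
...   | inj₂ (r , refl , refl) = inj₂ (r , ∈-shad⁺ z r , refl)

supp-𝟙 : ∀ n → supp (𝟙 {n}) ≡ []
supp-𝟙 zero = refl
supp-𝟙 (suc n) = cong (map suc) (supp-𝟙 n)

shad-𝟙 : ∀ n → shad (𝟙 {n}) ≡ []
shad-𝟙 zero = refl
shad-𝟙 (suc n) = cong (map (0 ∷_)) (shad-𝟙 n)

∉-supp-𝟙 : {z : Fin n} → z ∉ supp 𝟙
∉-supp-𝟙 {n} p with subst (_ ∈_) (supp-𝟙 n) p
... | ()

∉-shad-𝟙 : {d : Mon n} → d ∉ shad 𝟙
∉-shad-𝟙 {n} p with subst (_ ∈_) (shad-𝟙 n) p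
... | ()

shad-supp : ∀ (d m : Mon n) → d ∈ shad m → supp d ⊆ supp m
shad-supp d m p q with ∈-shad⁻ m p
... | x , refl = ∈-supp-·⁺ʳ x d q

-- Quadrics and cubics as products of variables.

qd : Fin n → Fin n → Mon n
qd x y = x · y · 𝟙

cb : Fin n → Fin n → Fin n → Mon n
cb x y z = x · y · z · 𝟙

deg-qd : ∀ {n} (x y : Fin n) → deg (qd x y) ≡ 2
deg-qd {n} x y = trans (deg-· x _) (cong suc (trans (deg-· y _) (cong suc (deg-𝟙 n))))

deg-cb : ∀ (x y z : Fin n) → deg (cb x y z) ≡ 3
deg-cb x y z = trans (deg-· x _) (cong suc (deg-qd y z))

qd-comm : ∀ (x y : Fin n) → qd x y ≡ qd y x
qd-comm x y = ·-comm x y 𝟙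

deg-1 : ∀ (m : Mon n) → deg m ≡ 1 → ∃ λ x → m ≡ x · 𝟙
deg-1 m p with deg-suc m p
... | x , m′ , refl , q = x , cong (x ·_) (deg-0 m′ q)

deg-2 : ∀ (m : Mon n) → deg m ≡ 2 → ∃ λ x → ∃ λ y → m ≡ qd x y
deg-2 m p with deg-suc m p
... | x , m′ , refl , q with deg-1 m′ q
...   | y , refl = x , y , refl

deg-3 : ∀ (m : Mon n) → deg m ≡ 3 → ∃ λ x → ∃ λ y → ∃ λ z → m ≡ cb x y z
deg-3 m p with deg-suc m p
... | x , m′ , refl , q with deg-2 m′ q
...   | y , z , refl = x , y , z , refl

∈-supp-1⁻ : ∀ (x : Fin n) {z} → z ∈ supp (x · 𝟙) → z ≡ x
∈-supp-1⁻ x p with ∈-supp-·⁻ x 𝟙 p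
... | inj₁ q = q
... | inj₂ q = ⊥-elim (∉-supp-𝟙 q)

∈-supp-qd⁻ : ∀ (x y : Fin n) {z} → z ∈ supp (qd x y) → z ≡ x ⊎ z ≡ y
∈-supp-qd⁻ x y p with ∈-supp-·⁻ x _ p
... | inj₁ q = inj₁ q
... | inj₂ q = inj₂ (∈-supp-1⁻ y q)

∈-supp-cb⁻ : ∀ (x y z : Fin n) {w} → w ∈ supp (cb x y z) → w ≡ x ⊎ w ≡ y ⊎ w ≡ z
∈-supp-cb⁻ x y z p with ∈-supp-·⁻ x _ p
... | inj₁ q = inj₁ q
... | inj₂ q = inj₂ (∈-supp-qd⁻ y z q)

∈-shad-1⁻ : ∀ (x : Fin n) {d} → d ∈ shad (x · 𝟙) → d ≡ 𝟙
∈-shad-1⁻ x p with ∈-shad-·⁻ x 𝟙 p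
... | inj₁ q = q
... | inj₂ (_ , q , _) = ⊥-elim (∉-shad-𝟙 q)

∈-shad-qd⁻ : ∀ (x y : Fin n) {d} → d ∈ shad (qd x y) → d ≡ y · 𝟙 ⊎ d ≡ x · 𝟙
∈-shad-qd⁻ x y p with ∈-shad-·⁻ x _ p
... | inj₁ q = inj₁ q
... | inj₂ (_ , q , refl) = inj₂ (cong (x ·_) (∈-shad-1⁻ y q))

∈-shad-cb⁻ : ∀ (x y z : Fin n) {d} → d ∈ shad (cb x y z) → d ≡ qd y z ⊎ d ≡ qd x z ⊎ d ≡ qd x y
∈-shad-cb⁻ x y z p with ∈-shad-·⁻ x _ p
... | inj₁ q = inj₁ q
... | inj₂ (_ , q , refl) with ∈-shad-qd⁻ y z q
...   | inj₁ refl = inj₂ (inj₁ refl)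
...   | inj₂ refl = inj₂ (inj₂ refl)

·𝟙-injective : ∀ (x y : Fin n) → x · 𝟙 ≡ y · 𝟙 → x ≡ y
·𝟙-injective x y p = ∈-supp-1⁻ y (subst (λ w → x ∈ supp w) p (∈-supp⁺ x 𝟙))

qd-injectiveʳ : ∀ (x y z : Fin n) → qd x y ≡ qd x z → y ≡ z
qd-injectiveʳ x y z p = ·𝟙-injective y z (·-cancel x p)

cb-rot : ∀ (x y z : Fin n) → cb x y z ≡ cb y z x
cb-rot x y z = trans (·-comm x y _) (cong (y ·_) (·-comm x z 𝟙))

yz∈cb : ∀ (x y z : Fin n) → qd y z ∈ shad (cb x y z)
yz∈cb x y z = ∈-shad⁺ x _

xz∈cb : ∀ (x y z : Fin n) → qd x z ∈ shad (cb x y z)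
xz∈cb x y z = subst (λ w → qd x z ∈ shad w) (·-comm y x _) (∈-shad⁺ y _)

xy∈cb : ∀ (x y z : Fin n) → qd x y ∈ shad (cb x y z)
xy∈cb x y z = subst (λ w → qd x y ∈ shad w) (sym (trans (cb-rot x y z) (cb-rot y z x))) (∈-shad⁺ z _)

-- Families of cubics

_∈ₘ?_ : (m : Mon n) (T : List (Mon n)) → Dec (m ∈ T)
_∈ₘ?_ = DecMembership._∈?_ _≟ₘ_

_∈ᵥ?_ : (x : Fin n) (xs : List (Fin n)) → Dec (x ∈ xs)
_∈ᵥ?_ = DecMembership._∈?_ Fin._≟_

module CQ {n} = Collect (_≟ₘ_ {n}) shad
module CV {n} = Collect (Fin._≟_ {n}) supp

-- `Q T` and `V T` are the degree 2 and degree 1 parts of the order ideal generated by the cubics in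
-- `T`, with variables standing for the linear monomials.
Q : List (Mon n) → List (Mon n)
Q = CQ.collect

V : List (Mon n) → List (Fin n)
V = CV.collect

#Q #V : List (Mon n) → ℕ
#Q T = length (Q T)
#V T = length (V T)

Q-unique : (T : List (Mon n)) → Unique (Q T)
Q-unique = CQ.collect-unique shad-unique

V-unique : (T : List (Mon n)) → Unique (V T)
V-unique = CV.collect-unique supp-unique

Cubic : Mon n → Set
Cubic m = deg m ≡ 3

Cubics : List (Mon n) → Set
Cubics T = Unique T × All Cubic T

supp-Q : ∀ (T : List (Mon n)) {d z} → d ∈ Q T → z ∈ supp d → z ∈ V T
supp-Q T {d} p q with CQ.∈-collect⁻ T p
... | m , m∈ , d∈ = CV.∈-collect⁺ m∈ (shad-supp d m d∈ q)

shad-cubic : ∀ {m d : Mon n} → Cubic m → d ∈ shad m → deg d ≡ 2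
shad-cubic {m = m} {d} c p with ∈-shad⁻ m p
... | x , refl = suc-injective (trans (sym (deg-· x d)) c)

Q-quadric : ∀ {T : List (Mon n)} {d} → All Cubic T → d ∈ Q T → deg d ≡ 2
Q-quadric {T = T} al p with CQ.∈-collect⁻ T p
... | m , m∈ , d∈ = shad-cubic {m = m} (All.lookup al m∈) d∈

new-∉ : ∀ {T : List (Mon n)} {m d} → d ∈ shad m → d ∉ Q T → m ∉ T
new-∉ p q m∈ = q (CQ.∈-collect⁺ m∈ p)

cubics-∷ : ∀ {T : List (Mon n)} {m} → Cubics T → Cubic m → m ∉ T → Cubics (m ∷ T)
cubics-∷ (u , al) c m∉ = unique-∷ m∉ u , c ∷ al

-- The ambient number of variables is left free and may exceed r, since r counts only the variables
-- that occur. Fresh variables can thus be adjoined at will.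
record Realizable (r q c : ℕ) : Set where
  constructor realize
  field
    {vars} : ℕ
    family : List (Mon vars)
    cubics : Cubics family
    #vars≡ : #V family ≡ r
    #quads≡ : #Q family ≡ q
    #cubics≡ : length family ≡ c

-- Induction on the family. A cubic without old quadrics brings as many quadrics as it has
-- variables. Otherwise it is x d with d old, so x is its only possible new variable, and if x is
-- new then some quadric containing x is new too.
#V≤#Q : (T : List (Mon n)) → All Cubic T → #V T ≤ #Q T
#V≤#Q [] _ = z≤n
#V≤#Q (m ∷ T) (c ∷ al) with any? (λ d → d ∈ₘ? Q T) (shad m)
... | no none = begin
  #V (m ∷ T)                    ≤⟨ CV.length-union-≤ (supp m) (V T) ⟩
  length (supp m) + #V T        ≤⟨ +-monoʳ-≤ (length (supp m)) (#V≤#Q T al) ⟩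
  length (supp m) + #Q T        ≡⟨ cong (_+ #Q T) (sym (length-shad m)) ⟩
  length (shad m) + #Q T        ≡⟨ sym (CQ.length-union-new λ p q → none (lose p q)) ⟩
  #Q (m ∷ T)                    ∎
  where
  open ≤-Reasoning
... | yes some with find some
...   | d , d∈m , d∈T with ∈-shad⁻ m d∈m
...     | x , refl with x ∈ᵥ? V T
...       | yes x∈ = ≤-trans (≤-reflexive (cong length (CV.union-old {ds = supp m} sub)))
    (≤-trans (#V≤#Q T al) (length-⊆ (Q-unique T) (CQ.∈-union⁺ʳ {ds = shad m})))
  where
  sub : supp (x · d) ⊆ V T
  sub p with ∈-supp-·⁻ x d p
  ... | inj₁ refl = x∈
  ... | inj₂ q = supp-Q T d∈T q
...       | no x∉ = begin
  #V (m ∷ T)      ≤⟨ length-⊆ (V-unique (m ∷ T)) sub ⟩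
  suc (#V T)      ≤⟨ s≤s (#V≤#Q T al) ⟩
  suc (#Q T)      ≤⟨ grow ⟩
  #Q (m ∷ T)      ∎
  where
  open ≤-Reasoning
  sub : V (m ∷ T) ⊆ x ∷ V T
  sub p with CV.∈-union⁻ {ds = supp m} p
  ... | inj₂ q = there q
  ... | inj₁ q with ∈-supp-·⁻ x d q
  ...   | inj₁ refl = here refl
  ...   | inj₂ r = there (supp-Q T d∈T r)
  grow : suc (#Q T) ≤ #Q (m ∷ T)
  grow with deg-2 d (shad-cubic {m = m} c d∈m)
  -- With d = uv the quadric xu serves: it contains x, which no old quadric does.
  ... | u , v , refl = CQ.length-union-< (xy∈cb x u v) λ p → x∉ (supp-Q T p (∈-supp⁺ x _))

-- The number of quadrics in r variables

tri : ℕ → ℕ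
tri zero = 0
tri (suc r) = suc r + tri r

tri-mono : ∀ {r s} → r ≤ s → tri r ≤ tri s
tri-mono z≤n = z≤n
tri-mono (s≤s p) = +-mono-≤ (s≤s p) (tri-mono p)

pairs : List (Fin n) → List (Mon n)
pairs [] = []
pairs (x ∷ xs) = map (qd x) (x ∷ xs) ++ pairs xs

length-pairs : (xs : List (Fin n)) → length (pairs xs) ≡ tri (length xs)
length-pairs [] = refl
length-pairs (x ∷ xs) = cong suc (trans (length-++ (map (qd x) xs)) (cong₂ _+_ (length-map (qd x) xs) (length-pairs xs)))

∈-pairs⁻ : ∀ (xs : List (Fin n)) {d} → d ∈ pairs xs → ∃ λ x → ∃ λ y → x ∈ xs × y ∈ xs × d ≡ qd x y
∈-pairs⁻ (x ∷ xs) p with ∈-++⁻ (map (qd x) (x ∷ xs)) p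
... | inj₁ q with ∈-map⁻ (qd x) q
...   | y , y∈ , refl = x , y , here refl , y∈ , refl
∈-pairs⁻ (x ∷ xs) p | inj₂ q with ∈-pairs⁻ xs q
...   | y , z , y∈ , z∈ , refl = y , z , there y∈ , there z∈ , refl

∈-pairs⁺ : ∀ {xs : List (Fin n)} {x y} → x ∈ xs → y ∈ xs → qd x y ∈ pairs xs
∈-pairs⁺ {x = x} (here refl) q = ∈-++⁺ˡ (∈-map⁺ (qd x) q)
∈-pairs⁺ {xs = w ∷ ws} {x} (there p) (here refl) = ∈-++⁺ˡ (subst (_∈ map (qd w) (w ∷ ws)) (qd-comm w x) (∈-map⁺ (qd w) (there p)))
∈-pairs⁺ {xs = w ∷ ws} (there p) (there q) = ∈-++⁺ʳ (map (qd w) (w ∷ ws)) (∈-pairs⁺ p q)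

pairs-unique : {xs : List (Fin n)} → Unique xs → Unique (pairs xs)
pairs-unique {xs = []} _ = []
pairs-unique {xs = x ∷ xs} u@(_ ∷ u′) = Unique.++⁺ (Unique.map⁺ (λ {y} {z} → qd-injectiveʳ x y z) u) (pairs-unique u′) dis
  where
  dis : ∀ {d} → ¬ (d ∈ map (qd x) (x ∷ xs) × d ∈ pairs xs)
  dis (p , q) with ∈-map⁻ (qd x) p | ∈-pairs⁻ xs q
  ... | y , _ , refl | a , b , a∈ , b∈ , eq with ∈-supp-qd⁻ a b (subst (λ w → x ∈ supp w) eq (∈-supp⁺ x _))
  ...   | inj₁ refl = Unique.Unique[x∷xs]⇒x∉xs u a∈
  ...   | inj₂ refl = Unique.Unique[x∷xs]⇒x∉xs u b∈

Q⊆pairs : (T : List (Mon n)) → All Cubic T → Q T ⊆ pairs (V T)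
Q⊆pairs T al {d} p with deg-2 d (Q-quadric al p)
... | x , y , refl = ∈-pairs⁺ (supp-Q T p (∈-supp⁺ x _)) (supp-Q T p (∈-supp-·⁺ʳ x _ (∈-supp⁺ y _)))

#Q≤tri : (T : List (Mon n)) → All Cubic T → #Q T ≤ tri (#V T)
#Q≤tri T al = ≤-trans (length-⊆ (Q-unique T) (Q⊆pairs T al)) (≤-reflexive (length-pairs (V T)))

-- Adding cubics

supp-cb⊆ : ∀ {x y z : Fin n} {xs} → x ∈ xs → y ∈ xs → z ∈ xs → supp (cb x y z) ⊆ xs
supp-cb⊆ {x = x} {y} {z} a b c p with ∈-supp-cb⁻ x y z p
... | inj₁ refl = a
... | inj₂ (inj₁ refl) = b
... | inj₂ (inj₂ refl) = c

xxy-shad : ∀ (x y : Fin n) {d} → d ∈ shad (cb x x y) → d ≡ qd x y ⊎ d ≡ qd x x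
xxy-shad x y p with ∈-shad-cb⁻ x x y p
... | inj₁ q = inj₁ q
... | inj₂ (inj₁ q) = inj₁ q
... | inj₂ (inj₂ q) = inj₂ q

-- By counting, some quadric xy in the present variables is missing. If x² is missing too, x³ adds
-- x² alone; otherwise x²y adds xy alone. No variable is new.
add-one : ∀ {r q c} → Realizable r q c → q < tri r → Realizable r (suc q) (suc c)
add-one (realize T cs@(_ , al) refl refl refl) lt with any? (λ d → ¬? (d ∈ₘ? Q T)) (pairs (V T))
... | no none = ⊥-elim (<⇒≱ lt (≤-trans (≤-reflexive (sym (length-pairs (V T))))
        (length-⊆ (pairs-unique (V-unique T)) λ {d} p → decidable-stable (d ∈ₘ? Q T) λ d∉ → none (lose p d∉))))
... | yes some with find some
...   | d , d∈ , d∉ with ∈-pairs⁻ (V T) d∈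
...     | x , y , x∈ , y∈ , refl with qd x x ∈ₘ? Q T
...       | no xx∉ = realize (cb x x x ∷ T) (cubics-∷ cs (deg-cb x x x) (new-∉ (yz∈cb x x x) xx∉))
              (cong length (CV.union-old (supp-cb⊆ x∈ x∈ x∈)))
              (CQ.length-union-≡ [ qd x x ] (shad-unique (cb x x x)) (Q-unique T) ([] ∷ [])
                (λ { (here refl) → yz∈cb x x x }) (λ { (here refl) → xx∉ }) λ p → inj₁ (cov p)) refl
  where
  cov : ∀ {d} → d ∈ shad (cb x x x) → d ∈ [ qd x x ]
  cov p with xxy-shad x x p
  ... | inj₁ q = here q
  ... | inj₂ q = here q
...       | yes xx∈ = realize (cb x x y ∷ T) (cubics-∷ cs (deg-cb x x y) (new-∉ (yz∈cb x x y) d∉))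
              (cong length (CV.union-old (supp-cb⊆ x∈ x∈ y∈)))
              (CQ.length-union-≡ [ qd x y ] (shad-unique (cb x x y)) (Q-unique T) ([] ∷ [])
                (λ { (here refl) → yz∈cb x x y }) (λ { (here refl) → d∉ }) cov) refl
  where
  cov : ∀ {d} → d ∈ shad (cb x x y) → d ∈ [ qd x y ] ⊎ d ∈ Q T
  cov p with xxy-shad x y p
  ... | inj₁ q = inj₁ (here q)
  ... | inj₂ refl = inj₂ xx∈

isolated : ∀ {T : List (Mon n)} {m} → Cubics T → Cubic m → (∀ {z} → z ∈ supp m → z ∉ V T) →
  Realizable (length (supp m) + #V T) (length (supp m) + #Q T) (suc (length T))
isolated {T = T} {m} cs c new = realize (m ∷ T) (cubics-∷ cs c m∉) (CV.length-union-new new)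
  (trans (CQ.length-union-new (λ {d} p → newQ p)) (cong (_+ #Q T) (length-shad m))) refl
  where
  newQ : ∀ {d} → d ∈ shad m → d ∉ Q T
  newQ {d} p q with deg-2 d (shad-cubic {m = m} c p)
  ... | u , v , refl = new (shad-supp d m p (∈-supp⁺ u _)) (supp-Q T q (∈-supp⁺ u _))
  m∉ : m ∉ T
  m∉ p with deg-suc m c
  ... | x , m′ , refl , _ = new (∈-supp⁺ x m′) (CV.∈-collect⁺ p (∈-supp⁺ x m′))

-- Adjoining fresh variables.

lift : List (Mon n) → List (Mon (suc n))
lift = map (0 ∷_)

cubics-lift : ∀ {T : List (Mon n)} → Cubics T → Cubics (lift T)
cubics-lift (u , al) = Unique.map⁺ Vec.∷-injectiveʳ u , All.map⁺ al

∈-V-lift⁻ : ∀ (T : List (Mon n)) {z} → z ∈ V (lift T) → ∃ λ x → x ∈ V T × z ≡ suc x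
∈-V-lift⁻ T p with CV.∈-collect⁻ (lift T) p
... | m , m∈ , z∈ with ∈-map⁻ (0 ∷_) m∈
...   | m′ , m′∈ , refl with ∈-map⁻ suc z∈
...     | x , x∈ , refl = x , CV.∈-collect⁺ m′∈ x∈ , refl

∈-Q-lift⁻ : ∀ (T : List (Mon n)) {d} → d ∈ Q (lift T) → ∃ λ e → e ∈ Q T × d ≡ 0 ∷ e
∈-Q-lift⁻ T p with CQ.∈-collect⁻ (lift T) p
... | m , m∈ , d∈ with ∈-map⁻ (0 ∷_) m∈
...   | m′ , m′∈ , refl with ∈-map⁻ (0 ∷_) d∈
...     | e , e∈ , refl = e , CQ.∈-collect⁺ m′∈ e∈ , refl

∈-V-lift⁺ : ∀ {T : List (Mon n)} {x} → x ∈ V T → suc x ∈ V (lift T)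
∈-V-lift⁺ {T = T} p with CV.∈-collect⁻ T p
... | m , m∈ , x∈ = CV.∈-collect⁺ (∈-map⁺ (0 ∷_) m∈) (∈-map⁺ suc x∈)

∈-Q-lift⁺ : ∀ {T : List (Mon n)} {d} → d ∈ Q T → 0 ∷ d ∈ Q (lift T)
∈-Q-lift⁺ {T = T} p with CQ.∈-collect⁻ T p
... | m , m∈ , d∈ = CQ.∈-collect⁺ (∈-map⁺ (0 ∷_) m∈) (∈-map⁺ (0 ∷_) d∈)

#V-lift : (T : List (Mon n)) → #V (lift T) ≡ #V T
#V-lift T = trans (length-≈ (V-unique (lift T)) (Unique.map⁺ Fin.suc-injective (V-unique T)) to from) (length-map suc (V T))
  where
  to : V (lift T) ⊆ map suc (V T)
  to p with ∈-V-lift⁻ T p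
  ... | x , x∈ , refl = ∈-map⁺ suc x∈
  from : map suc (V T) ⊆ V (lift T)
  from p with ∈-map⁻ suc p
  ... | x , x∈ , refl = ∈-V-lift⁺ {T = T} x∈

#Q-lift : (T : List (Mon n)) → #Q (lift T) ≡ #Q T
#Q-lift T = trans (length-≈ (Q-unique (lift T)) (Unique.map⁺ Vec.∷-injectiveʳ (Q-unique T)) to from) (length-map (0 ∷_) (Q T))
  where
  to : Q (lift T) ⊆ map (0 ∷_) (Q T)
  to p with ∈-Q-lift⁻ T p
  ... | x , x∈ , refl = ∈-map⁺ (0 ∷_) x∈
  from : map (0 ∷_) (Q T) ⊆ Q (lift T)
  from p with ∈-map⁻ (0 ∷_) p
  ... | x , x∈ , refl = ∈-Q-lift⁺ {T = T} x∈

-- The cubics x³, x²y and xyz have k = 1, 2 and 3 variables and equally many quadrics. Three fresh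
-- variables are adjoined in every case, of which k are used.
add-isolated : ∀ {r q c k} → Realizable r q c → 1 ≤ k → k ≤ 3 → Realizable (k + r) (k + q) (suc c)
add-isolated {k = k} (realize {n} T cs refl refl refl) 1≤k k≤3 = go k 1≤k k≤3
  where
  T³ : List (Mon (3 + n))
  T³ = lift (lift (lift T))
  #V³ : #V T³ ≡ #V T
  #V³ = trans (#V-lift (lift (lift T))) (trans (#V-lift (lift T)) (#V-lift T))
  #Q³ : #Q T³ ≡ #Q T
  #Q³ = trans (#Q-lift (lift (lift T))) (trans (#Q-lift (lift T)) (#Q-lift T))
  #T³ : length T³ ≡ length T
  #T³ = trans (length-map _ (lift (lift T))) (trans (length-map _ (lift T)) (length-map _ T))
  old : ∀ {z} → z ∈ V T³ → ∃ λ x → z ≡ suc (suc (suc x))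
  old p with ∈-V-lift⁻ (lift (lift T)) p
  ... | _ , q , refl with ∈-V-lift⁻ (lift T) q
  ...   | _ , s , refl with ∈-V-lift⁻ T s
  ...     | x , _ , refl = x , refl
  build : ∀ {k} m → Cubic m → length (supp m) ≡ k → (∀ {z} → z ∈ supp m → z ∉ V T³) →
    Realizable (k + #V T) (k + #Q T) (suc (length T))
  build m c refl new with isolated {m = m} (cubics-lift (cubics-lift (cubics-lift cs))) c new
  ... | R rewrite #V³ | #Q³ | #T³ = R
  go : ∀ k → 1 ≤ k → k ≤ 3 → Realizable (k + #V T) (k + #Q T) (suc (length T))
  go 1 _ _ = build (3 ∷ 0 ∷ 0 ∷ 𝟙) (cong (3 +_) (deg-𝟙 n)) len new
    where
    len : length (supp (3 ∷ 0 ∷ 0 ∷ 𝟙 {n})) ≡ 1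
    len rewrite supp-𝟙 n = refl
    new : ∀ {z} → z ∈ supp (3 ∷ 0 ∷ 0 ∷ 𝟙 {n}) → z ∉ V T³
    new p q rewrite supp-𝟙 n with p | old q
    ... | here refl | _ , ()
  go 2 _ _ = build (2 ∷ 1 ∷ 0 ∷ 𝟙) (cong (3 +_) (deg-𝟙 n)) len new
    where
    len : length (supp (2 ∷ 1 ∷ 0 ∷ 𝟙 {n})) ≡ 2
    len rewrite supp-𝟙 n = refl
    new : ∀ {z} → z ∈ supp (2 ∷ 1 ∷ 0 ∷ 𝟙 {n}) → z ∉ V T³
    new p q rewrite supp-𝟙 n with p | old q
    ... | here refl | _ , ()
    ... | there (here refl) | _ , ()
  go 3 _ _ = build (1 ∷ 1 ∷ 1 ∷ 𝟙) (cong (3 +_) (deg-𝟙 n)) len new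
    where
    len : length (supp (1 ∷ 1 ∷ 1 ∷ 𝟙 {n})) ≡ 3
    len rewrite supp-𝟙 n = refl
    new : ∀ {z} → z ∈ supp (1 ∷ 1 ∷ 1 ∷ 𝟙 {n}) → z ∉ V T³
    new p q rewrite supp-𝟙 n with p | old q
    ... | here refl | _ , ()
    ... | there (here refl) | _ , ()
    ... | there (there (here refl)) | _ , ()
  go (suc (suc (suc (suc _)))) _ (s≤s (s≤s (s≤s ())))

-- Removing redundant cubics

-- The head is dropped when all its quadrics, and hence all its variables, occur in the tail.
-- Otherwise it is kept, and as it brings at least one quadric, the tail satisfies the bound with c
-- lowered by one; c = 0 cannot happen, since a cubic has a quadric.
thin : ∀ (T : List (Mon n)) c → Cubics T → #Q T ≤ c → c ≤ length T →
  ∃ λ T′ → Cubics T′ × T′ ⊆ T × Q T′ ≡ Q T × V T′ ≡ V T × length T′ ≡ c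
thin [] zero cs _ _ = [] , cs , id , refl , refl , refl
thin (m ∷ T) c cs@(u ∷ us , d ∷ ds) q≤c c≤ with c ℕ.≟ suc (length T)
... | yes refl = m ∷ T , cs , id , refl , refl , refl
... | no c≢ with all? (λ d → d ∈ₘ? Q T) (shad m)
...   | yes old with thin T c (us , ds) (subst (λ z → length z ≤ c) (CQ.union-old {ds = shad m} (All.lookup old)) q≤c) (≤-pred (≤∧≢⇒< c≤ c≢))
...     | T′ , cs′ , sub , qe , ve , len = T′ , cs′ , there ∘ sub , trans qe (sym (CQ.union-old (All.lookup old)))
          , trans ve (sym (CV.union-old oldV)) , len
  where
  oldV : supp m ⊆ V T
  oldV {z} p with ∈-supp⁻ m p
  ... | m′ , refl with deg-2 m′ (suc-injective (trans (sym (deg-· z m′)) d))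
  ...   | a , b , refl = supp-Q T (All.lookup old (xy∈cb z a b)) (∈-supp⁺ z _)
thin (m ∷ T) zero (u ∷ us , d ∷ ds) q≤c c≤ | no c≢ | no new with deg-3 m d
... | a , b , e , refl = ⊥-elim (<⇒≱ (∈-length (CQ.∈-union⁺ˡ {ds = shad m} {Q T} (xy∈cb a b e))) q≤c)
thin (m ∷ T) (suc c) (u ∷ us , d ∷ ds) q≤c (s≤s c≤) | no c≢ | no new
  with thin T c (us , ds) (≤-pred (≤-trans grow q≤c)) c≤
  where
  grow : #Q T < #Q (m ∷ T)
  grow with find (All.¬All⇒Any¬ (λ d → d ∈ₘ? Q T) (shad m) new)
  ... | e , e∈ , e∉ = CQ.length-union-< e∈ e∉
... | T′ , cs′ , sub , qe , ve , len = m ∷ T′ , cubics-∷ cs′ d (λ p → All.All¬⇒¬Any u (sub p))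
      , (λ { (here p) → here p ; (there p) → there (sub p) })
      , cong (CQ.union (shad m)) qe , cong (CV.union (supp m)) ve , cong suc len

add-ones : ∀ {r q c} i → Realizable r q c → i + q ≤ tri r → Realizable r (i + q) (i + c)
add-ones zero R _ = R
add-ones (suc i) R p = add-one (add-ones i R (<⇒≤ p)) p

-- In the region q ≤ c every cubic beyond one per quadric is redundant.
thin-region : ∀ {r q c q* c*} → Realizable r q c → q ≤ q* → q* ≤ c* → c* ≤ c → q* ≤ tri r → Realizable r q* c*
thin-region {r} {q} {c} {q*} {c*} R q≤ q≤c c≤ q*≤ =
  -- First the quadrics are raised to q*, which adds as many cubics; afterwards the cubics are
  -- thinned to c*.
  cut (subst (λ z → Realizable r z (q* ∸ q + c)) (m∸n+n≡m q≤) (add-ones (q* ∸ q) R (subst (_≤ tri r) (sym (m∸n+n≡m q≤)) q*≤)))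
  where
  cut : Realizable r q* (q* ∸ q + c) → Realizable r q* c*
  cut (realize T cs refl refl len) with thin T c* cs q≤c (≤-trans c≤ (≤-trans (m≤n+m c _) (≤-reflexive (sym len))))
  ... | T′ , cs′ , _ , qe , ve , len′ = realize T′ cs′ (cong length ve) (cong length qe) len′

-- Spreading few cubics over many quadrics

-- Each cubic can absorb between one and three of the ρ variables. One cubic takes three, or fewer
-- if just one each would be left for the others.
add-isolates : ∀ {r q c} b ρ → Realizable r q c → b ≤ ρ → ρ ≤ 3 * b → Realizable (ρ + r) (ρ + q) (b + c)
add-isolates zero zero R _ _ = R
add-isolates {r} {q} {c} (suc b) ρ R b<ρ ρ≤ with ρ ∸ b ≤? 3
... | yes p = subst₂ (λ s t → Realizable s t (suc (b + c))) (eq r) (eq q)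
      (add-isolated {k = ρ ∸ b} (add-isolates b b R ≤-refl (m≤m+n b _)) (m<n⇒0<n∸m b<ρ) p)
  where
  eq : ∀ x → ρ ∸ b + (b + x) ≡ ρ + x
  eq x = trans (sym (+-assoc (ρ ∸ b) b x)) (cong (_+ x) (m∸n+n≡m (<⇒≤ b<ρ)))
... | no p = subst₂ (λ s t → Realizable s t (suc (b + c))) (eq r) (eq q)
      (add-isolated {k = 3} (add-isolates b (ρ ∸ 3) R b≤ρ-3 ρ-3≤) (s≤s z≤n) ≤-refl)
  where
  3+b≤ρ : 3 + b ≤ ρ
  3+b≤ρ = ≤-trans (+-monoˡ-≤ b (<⇒≤ (≰⇒> p))) (≤-reflexive (m∸n+n≡m (<⇒≤ b<ρ)))
  b≤ρ-3 : b ≤ ρ ∸ 3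
  b≤ρ-3 = m+n≤o⇒m≤o∸n b (≤-trans (≤-reflexive (+-comm b 3)) 3+b≤ρ)
  ρ-3≤ : ρ ∸ 3 ≤ 3 * b
  ρ-3≤ = m≤n+o⇒m∸n≤o ρ 3 (≤-trans ρ≤ (≤-reflexive (*-suc 3 b)))
  eq : ∀ x → 3 + (ρ ∸ 3 + x) ≡ ρ + x
  eq x = trans (sym (+-assoc 3 (ρ ∸ 3) x)) (cong (_+ x) (m+[n∸m]≡n (≤-trans (m≤m+n 3 b) 3+b≤ρ)))

fill : ∀ {r q c} i b ρ → Realizable r q c → b ≤ ρ → ρ ≤ 3 * b → q + ρ + i ≤ tri (r + ρ) →
  Realizable (r + ρ) (q + ρ + i) (c + b + i)
fill {r} {q} {c} i b ρ R p₁ p₂ p₃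
  rewrite +-comm r ρ | +-comm q ρ | +-comm c b | +-comm (ρ + q) i | +-comm (b + c) i =
  add-ones i (add-isolates b ρ R p₁ p₂) p₃

-- To be read for cubics, where three distinct variables mean that no square divides.
Sqfree : Mon n → Set
Sqfree m = length (supp m) ≡ 3

sqfree? : (m : Mon n) → Dec (Sqfree m)
sqfree? m = length (supp m) ℕ.≟ 3

length-pair-⊆ : ∀ {m : Mon n} a b → supp m ⊆ a ∷ b ∷ [] → ¬ Sqfree m
length-pair-⊆ {m = m} a b sub sq with subst (_≤ 2) sq (length-⊆ {ys = a ∷ b ∷ []} (supp-unique m) sub)
... | s≤s (s≤s ())

sqfree-distinct : ∀ (x y z : Fin n) → Sqfree (cb x y z) → x ≢ y × x ≢ z × y ≢ z
sqfree-distinct x y z sq =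
    (λ { refl → length-pair-⊆ {m = cb x x z} x z (supp-cb⊆ (here refl) (here refl) (there (here refl))) sq })
  , (λ { refl → length-pair-⊆ {m = cb x y x} x y (supp-cb⊆ (here refl) (there (here refl)) (here refl)) sq })
  , (λ { refl → length-pair-⊆ {m = cb x y y} x y (supp-cb⊆ (here refl) (there (here refl)) (there (here refl))) sq })

square∉Q : ∀ {T : List (Mon n)} → All Sqfree T → ∀ x → qd x x ∉ Q T
square∉Q {T = T} sq x p with CQ.∈-collect⁻ T p
... | m , m∈ , d∈ with ∈-shad⁻ m d∈
...   | w , refl = proj₂ (proj₂ (sqfree-distinct w x x (All.lookup sq m∈))) refl

-- Replaces xyz by a²w with a, w among x, y, z, losing exactly one quadric.
add-square : ∀ {T : List (Mon n)} {m} → Cubics T → ∀ a w → a ∈ V T → qd a a ∉ Q T → qd a w ∉ Q T → a ≢ w →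
  w ∈ supp m → supp m ⊆ w ∷ V T → Realizable (#V (m ∷ T)) (2 + #Q T) (suc (length T))
add-square {n} {T} {m} cs a w a∈ aa∉ aw∉ a≢w w∈ sub = realize (cb a a w ∷ T) (cubics-∷ cs (deg-cb a a w) (new-∉ (yz∈cb a a w) aw∉))
  (length-≈ (V-unique (cb a a w ∷ T)) (V-unique (m ∷ T)) to from)
  (CQ.length-union-≡ (qd a a ∷ qd a w ∷ []) (shad-unique (cb a a w)) (Q-unique T)
    (((λ eq → a≢w (qd-injectiveʳ a a w eq)) ∷ []) ∷ [] ∷ [])
    (λ { (here refl) → xy∈cb a a w ; (there (here refl)) → yz∈cb a a w })
    (λ { (here refl) → aa∉ ; (there (here refl)) → aw∉ })
    cov) refl
  where
  cov : ∀ {d} → d ∈ shad (cb a a w) → d ∈ qd a a ∷ qd a w ∷ [] ⊎ d ∈ Q T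
  cov p with xxy-shad a w p
  ... | inj₁ q = inj₁ (there (here q))
  ... | inj₂ q = inj₁ (here q)
  to : V (cb a a w ∷ T) ⊆ V (m ∷ T)
  to p with CV.∈-union⁻ {ds = supp (cb a a w)} p
  ... | inj₁ q = supp-cb⊆ (CV.∈-union⁺ʳ {ds = supp m} a∈) (CV.∈-union⁺ʳ {ds = supp m} a∈) (CV.∈-union⁺ˡ {ds = supp m} w∈) q
  ... | inj₂ q = CV.∈-union⁺ʳ {ds = supp m} q
  from : V (m ∷ T) ⊆ V (cb a a w ∷ T)
  from p with CV.∈-union⁻ {ds = supp m} p
  ... | inj₂ q = CV.∈-union⁺ʳ {ds = supp (cb a a w)} q
  ... | inj₁ q with sub q
  ...   | here refl = CV.∈-union⁺ˡ {ds = supp (cb a a w)} (∈-supp-·⁺ʳ a _ (∈-supp-·⁺ʳ a _ (∈-supp⁺ w _)))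
  ...   | there r = CV.∈-union⁺ʳ {ds = supp (cb a a w)} r

two-new : ∀ {T : List (Mon n)} {m} a b → a ≢ b → a ∈ supp m → b ∈ supp m → a ∉ V T → b ∉ V T → ¬ #V (m ∷ T) ≤ 1 + #V T
two-new {T = T} {m} a b a≢b a∈ b∈ a∉ b∉ le = 1+n≰n (≤-trans (length-⊆ u sub) le)
  where
  u : Unique (a ∷ b ∷ V T)
  u = unique-∷ (λ { (here p) → a≢b p ; (there p) → a∉ p }) (unique-∷ b∉ (V-unique T))
  sub : a ∷ b ∷ V T ⊆ V (m ∷ T)
  sub (here refl) = CV.∈-union⁺ˡ {ds = supp m} a∈
  sub (there (here refl)) = CV.∈-union⁺ˡ {ds = supp m} b∈
  sub (there (there p)) = CV.∈-union⁺ʳ {ds = supp m} p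

-- A cubic has at most three quadric divisors, so a gain of three forces all three to exist and to
-- be new.
all-new : ∀ {T : List (Mon n)} {m} → Cubic m → 3 + #Q T ≤ #Q (m ∷ T) → Sqfree m × (∀ {d} → d ∈ shad m → d ∉ Q T)
all-new {T = T} {m} c le = sq , new
  where
  len : 3 ≤ length (shad m)
  len = +-cancelʳ-≤ (#Q T) 3 _ (≤-trans le (CQ.length-union-≤ (shad m) (Q T)))
  sq : Sqfree m
  sq = ≤-antisym (≤-trans (length-supp-≤ m) (≤-reflexive c)) (≤-trans len (≤-reflexive (length-shad m)))
  new : ∀ {d} → d ∈ shad m → d ∉ Q T
  new p q = <⇒≱ (filter-notAll (λ d → ¬? (d ∈ₘ? Q T)) (shad m) (lose p λ k → k q))
    (≤-trans (≤-reflexive (trans (length-shad m) sq))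
      (+-cancelʳ-≤ (#Q T) 3 _ (≤-trans le (≤-reflexive (length-++ (filter (λ d → ¬? (d ∈ₘ? Q T)) (shad m)))))))

-- Three private quadrics make m = xyz squarefree, and then `T` is squarefree and no square lies in
-- `Q T`. At most one of x, y, z is a new variable, so `add-square` applies with a old and with w
-- covering the new variable, if there is one.
lose-one : ∀ {T : List (Mon n)} {m} → Cubics T → (Sqfree m → All Sqfree T) → Cubic m →
  3 + #Q T ≤ #Q (m ∷ T) → #V (m ∷ T) ≤ 1 + #V T → Realizable (#V (m ∷ T)) (2 + #Q T) (suc (length T))
lose-one {T = T} {m} cs sqs c le₁ le₂ with all-new {T = T} {m} c le₁ | deg-3 m c
... | sq , new | x , y , z , refl with sqfree-distinct x y z sq | x ∈ᵥ? V T | y ∈ᵥ? V T | z ∈ᵥ? V T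
...   | x≢y , x≢z , y≢z | no x∉ | no y∉ | _ = ⊥-elim (two-new {T = T} {cb x y z} x y x≢y (∈-supp⁺ x _) (∈-supp-·⁺ʳ x _ (∈-supp⁺ y _)) x∉ y∉ le₂)
...   | x≢y , x≢z , y≢z | no x∉ | yes y∈ | no z∉ = ⊥-elim (two-new {T = T} {cb x y z} x z x≢z (∈-supp⁺ x _) (∈-supp-·⁺ʳ x _ (∈-supp-·⁺ʳ y _ (∈-supp⁺ z _))) x∉ z∉ le₂)
...   | x≢y , x≢z , y≢z | no x∉ | yes y∈ | yes z∈ = add-square {T = T} {cb x y z} cs y x y∈ (square∉Q (sqs sq) y)
          (new (subst (_∈ shad m) (qd-comm x y) (xy∈cb x y z))) (x≢y ∘ sym) (∈-supp⁺ x _)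
          (supp-cb⊆ (here refl) (there y∈) (there z∈))
...   | x≢y , x≢z , y≢z | yes x∈ | no y∉ | no z∉ = ⊥-elim (two-new {T = T} {cb x y z} y z y≢z (∈-supp-·⁺ʳ x _ (∈-supp⁺ y _)) (∈-supp-·⁺ʳ x _ (∈-supp-·⁺ʳ y _ (∈-supp⁺ z _))) y∉ z∉ le₂)
...   | x≢y , x≢z , y≢z | yes x∈ | no y∉ | yes z∈ = add-square {T = T} {cb x y z} cs x y x∈ (square∉Q (sqs sq) x)
          (new (xy∈cb x y z)) x≢y (∈-supp-·⁺ʳ x _ (∈-supp⁺ y _)) (supp-cb⊆ (there x∈) (here refl) (there z∈))
...   | x≢y , x≢z , y≢z | yes x∈ | yes y∈ | _ = add-square {T = T} {cb x y z} cs x z x∈ (square∉Q (sqs sq) x)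
          (new (xz∈cb x y z)) x≢z (∈-supp-·⁺ʳ x _ (∈-supp-·⁺ʳ y _ (∈-supp⁺ z _))) (supp-cb⊆ (there x∈) (there y∈) (here refl))

-- In such a list the cubics that are not squarefree come first. When a squarefree one is at the
-- head, all that remain are squarefree.
SqfreeLast : List (Mon n) → Set
SqfreeLast = AllPairs (λ m m′ → Sqfree m → Sqfree m′)

realizable-[] : Realizable 0 0 0
realizable-[] = realize {vars = 0} [] ([] , []) refl refl refl

-- End of the sweep, with no old cubics left. Only a = q - ρ of the i pending cubics add a quadric
-- beyond the isolated ones; the other i - a join the isolated cubics, which share the same ρ
-- variables. There are enough variables for them because b + i ≤ q.
spread-[] : ∀ i b ρ q → b ≤ ρ → ρ ≤ 3 * b → ρ ≤ q → b + i ≤ q → q ≤ ρ + i → q ≤ tri ρ → Realizable ρ q (b + i)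
spread-[] i b ρ q b≤ρ ρ≤ ρ≤q bi≤q q≤ q≤tri = subst₂ (Realizable ρ) eq₁ eq₂
  (add-ones (q ∸ ρ) (subst₂ (λ s t → Realizable s t (b′ + 0)) (+-identityʳ ρ) (+-identityʳ ρ)
     (add-isolates b′ ρ realizable-[] b′≤ρ (≤-trans ρ≤ (*-monoʳ-≤ 3 b≤b′))))
     (subst (_≤ tri ρ) (sym eq₁) q≤tri))
  where
  a = q ∸ ρ
  a≤i : a ≤ i
  a≤i = m≤n+o⇒m∸n≤o q ρ q≤
  b′ = b + (i ∸ a)
  b≤b′ : b ≤ b′
  b≤b′ = m≤m+n b _
  eq₁ : q ∸ ρ + ρ ≡ q
  eq₁ = m∸n+n≡m ρ≤q
  sum : a + b′ ≡ b + i
  sum = trans (+-comm a b′) (trans (+-assoc b _ a) (cong (b +_) (m∸n+n≡m a≤i)))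
  eq₂ : a + (b′ + 0) ≡ b + i
  eq₂ = trans (cong (a +_) (+-identityʳ b′)) sum
  b′≤ρ : b′ ≤ ρ
  b′≤ρ = +-cancelˡ-≤ a _ _ (≤-trans (≤-reflexive sum) (≤-trans bi≤q (≤-reflexive (sym eq₁))))

private
  shift : ∀ k v ρ → k + v + ρ ≡ v + (k + ρ)
  shift = solve-∀
  toOnes : ∀ l b i → suc l + b + i ≡ l + b + suc i
  toOnes = solve-∀
  toIsolated : ∀ l b i → suc l + b + i ≡ l + suc b + i
  toIsolated = solve-∀
  dropTwo : ∀ q ρ i → 3 + q + ρ + i ≡ suc (q + (2 + ρ) + i)
  dropTwo = solve-∀
  skipOnes : ∀ q ρ i → suc (q + ρ + suc i) ≡ 2 + q + ρ + i
  skipOnes = solve-∀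
  skipIsolated : ∀ q ρ i → suc (q + suc ρ + i) ≡ 2 + q + ρ + i
  skipIsolated = solve-∀

-- Still to be added to T: i cubics with one new quadric each, and b isolated cubics in ρ variables.
spread : ∀ (T : List (Mon n)) → Cubics T → SqfreeLast T → ∀ i b ρ q → b ≤ ρ → ρ ≤ 3 * b →
  #V T + ρ ≤ q → length T + b + i ≤ q → q ≤ #Q T + ρ + i → q ≤ tri (#V T + ρ) →
  Realizable (#V T + ρ) q (length T + b + i)
spread T cs sl i b ρ q b≤ρ ρ≤ v≤q c≤q q≤ q≤tri with q ℕ.≟ #Q T + ρ + i
... | yes refl = fill i b ρ (realize T cs refl refl refl) b≤ρ ρ≤ q≤tri
spread [] cs sl i b ρ q b≤ρ ρ≤ v≤q c≤q q≤ q≤tri | no q≢ = spread-[] i b ρ q b≤ρ ρ≤ v≤q c≤q q≤ q≤tri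
-- Completing now would give more than q quadrics, so the head m is given up; k counts the variables
-- that occur in m but not in `T`.
spread (m ∷ T) (u ∷ us , c ∷ al) (s ∷ sl) i b ρ q b≤ρ ρ≤ v≤q c≤q q≤ q≤tri | no q≢ =
  go k k≤3 #V≡
  where
  newV = filter (λ d → ¬? (d ∈ᵥ? V T)) (supp m)
  k = length newV
  #V≡ : #V (m ∷ T) ≡ k + #V T
  #V≡ = length-++ newV
  k≤3 : k ≤ 3
  k≤3 = ≤-trans (length-filter _ (supp m)) (≤-trans (length-supp-≤ m) (≤-reflexive c))
  #Q≤ : #Q (m ∷ T) ≤ 3 + #Q T
  #Q≤ = ≤-trans (CQ.length-union-≤ (shad m) (Q T))
    (+-monoˡ-≤ (#Q T) (≤-trans (≤-reflexive (length-shad m)) (≤-trans (length-supp-≤ m) (≤-reflexive c))))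
  q< : q < #Q (m ∷ T) + ρ + i
  q< = ≤∧≢⇒< q≤ q≢
  q<₃ : q < 3 + #Q T + ρ + i
  q<₃ = ≤-trans q< (+-monoˡ-≤ i (+-monoˡ-≤ ρ #Q≤))
  q≤₂ : q ≤ #Q T + (2 + ρ) + i
  q≤₂ = ≤-pred (≤-trans q<₃ (≤-reflexive (dropTwo (#Q T) ρ i)))
  -- Applies when a refill with one new quadric would end up one below q. Then m has three private
  -- quadrics, and `lose-one` puts a cubic with two new ones in its place.
  special : 2 + #Q T + ρ + i ≤ q → #V (m ∷ T) ≤ 1 + #V T → Realizable (#V (m ∷ T) + ρ) q (suc (length T) + b + i)
  special ge le = subst (λ z → Realizable (#V (m ∷ T) + ρ) z (suc (length T) + b + i)) (sym q≡)
    (fill i b ρ (lose-one {T = T} {m} (us , al) (λ sq → All.map (λ h → h sq) s) c #Q≥ le) b≤ρ ρ≤ (subst (_≤ tri (#V (m ∷ T) + ρ)) q≡ q≤tri))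
    where
    q≡ : q ≡ 2 + #Q T + ρ + i
    q≡ = ≤-antisym (≤-pred q<₃) ge
    #Q≥ : 3 + #Q T ≤ #Q (m ∷ T)
    #Q≥ = +-cancelʳ-≤ ρ _ _ (+-cancelʳ-≤ i _ _ (≤-trans (s≤s ge) q<))
  isolate : ∀ k → 1 ≤ k → k ≤ 3 → #V (m ∷ T) ≡ k + #V T → q ≤ #Q T + (k + ρ) + i →
    Realizable (#V (m ∷ T) + ρ) q (suc (length T) + b + i)
  isolate k 1≤k k≤3 eq le = subst₂ (λ s t → Realizable s q t) (sym eqV) (sym (toIsolated (length T) b i))
    (spread T (us , al) sl i (suc b) (k + ρ) q (+-mono-≤ 1≤k b≤ρ)
      (≤-trans (+-mono-≤ k≤3 ρ≤) (≤-reflexive (sym (*-suc 3 b))))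
      (subst (_≤ q) eqV v≤q) (subst (_≤ q) (toIsolated (length T) b i) c≤q) le (subst (λ z → q ≤ tri z) eqV q≤tri))
    where
    eqV : #V (m ∷ T) + ρ ≡ #V T + (k + ρ)
    eqV = trans (cong (_+ ρ) eq) (shift k (#V T) ρ)
  go : ∀ k → k ≤ 3 → #V (m ∷ T) ≡ k + #V T → Realizable (#V (m ∷ T) + ρ) q (suc (length T) + b + i)
  go 0 _ eq with q ≤? #Q T + ρ + suc i
  ... | no gt = special (≤-trans (≤-reflexive (sym (skipOnes (#Q T) ρ i))) (≰⇒> gt)) (≤-trans (≤-reflexive eq) (n≤1+n _))
  ... | yes le = subst₂ (λ s t → Realizable (s + ρ) q t) (sym eq) (sym (toOnes (length T) b i))
    (spread T (us , al) sl (suc i) b ρ q b≤ρ ρ≤ (subst (λ z → z + ρ ≤ q) eq v≤q) (subst (_≤ q) (toOnes (length T) b i) c≤q) le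
      (subst (λ z → q ≤ tri (z + ρ)) eq q≤tri))
  go 1 _ eq with q ≤? #Q T + suc ρ + i
  ... | no gt = special (≤-trans (≤-reflexive (sym (skipIsolated (#Q T) ρ i))) (≰⇒> gt)) (≤-reflexive eq)
  ... | yes le = isolate 1 ≤-refl (s≤s z≤n) eq le
  -- At most three quadrics go with m and an isolated cubic in k ≥ 2 variables returns at least two,
  -- so q is not skipped.
  go 2 k≤ eq = isolate 2 (s≤s z≤n) k≤ eq q≤₂
  go 3 k≤ eq = isolate 3 (s≤s z≤n) k≤ eq (≤-trans q≤₂ (+-monoˡ-≤ i (+-monoʳ-≤ (#Q T) (n≤1+n _))))
  go (suc (suc (suc (suc _)))) (s≤s (s≤s (s≤s ()))) _

same-#V : ∀ {T T′ : List (Mon n)} → T ⊆ T′ → T′ ⊆ T → #V T ≡ #V T′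
same-#V {T = T} {T′} p q = length-≈ (V-unique T) (V-unique T′) (CV.collect-⊆ p) (CV.collect-⊆ q)

same-#Q : ∀ {T T′ : List (Mon n)} → T ⊆ T′ → T′ ⊆ T → #Q T ≡ #Q T′
same-#Q {T = T} {T′} p q = length-≈ (Q-unique T) (Q-unique T′) (CQ.collect-⊆ p) (CQ.collect-⊆ q)

allPairs-const : ∀ {P : A → Set} {R : A → A → Set} → (∀ {x y} → P x → P y → R x y) → ∀ {xs} → All P xs → AllPairs R xs
allPairs-const h [] = []
allPairs-const h (p ∷ ps) = All.map (h p) ps ∷ allPairs-const h ps

sqfree-last : ∀ (T : List (Mon n)) → Cubics T →
  ∃ λ T′ → Cubics T′ × SqfreeLast T′ × T ⊆ T′ × T′ ⊆ T
sqfree-last T (u , al) = N ++ F , (Unique.++⁺ (Unique.filter⁺ _ u) (Unique.filter⁺ _ u) dis , All.tabulate (All.lookup al ∘ from))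
  , AllPairs.++⁺ (allPairs-const (λ ns _ sq → ⊥-elim (ns sq)) allN) (allPairs-const (λ _ sq _ → sq) allF)
      (All.map (λ ns → All.map (λ sq _ → sq) allF) allN)
  , to , from
  where
  N = filter (¬? ∘ sqfree?) T
  F = filter sqfree? T
  allN : All (¬_ ∘ Sqfree) N
  allN = All.all-filter (¬? ∘ sqfree?) T
  allF : All Sqfree F
  allF = All.all-filter sqfree? T
  dis : ∀ {m} → ¬ (m ∈ N × m ∈ F)
  dis (p , q) = All.lookup allN p (All.lookup allF q)
  to : T ⊆ N ++ F
  to {m} p with sqfree? m
  ... | yes sq = ∈-++⁺ʳ N (∈-filter⁺ sqfree? p sq)
  ... | no ns = ∈-++⁺ˡ (∈-filter⁺ (¬? ∘ sqfree?) p ns)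
  from : N ++ F ⊆ T
  from p with ∈-++⁻ N p
  ... | inj₁ q = proj₁ (∈-filter⁻ (¬? ∘ sqfree?) q)
  ... | inj₂ q = proj₁ (∈-filter⁻ sqfree? q)

-- The c* - c additional cubics enter `spread` as pending ones. Its number of quadrics therefore
-- starts at q + (c* - c) and is lowered from there to q*.
spread-region : ∀ {r q c q* c*} → Realizable r q c → c ≤ c* → c* ≤ q* → r ≤ q* → q* ≤ q → Realizable r q* c*
spread-region {q* = q*} {c*} (realize T cs@(u , al) refl refl refl) c≤ c≤q r≤q q≤ with sqfree-last T cs
... | T′ , cs′@(u′ , al′) , sl , to , from = subst₂ (λ s t → Realizable s q* t) eqV eqc
  (spread T′ cs′ sl (c* ∸ length T) 0 0 q* z≤n z≤n (≤-trans (≤-reflexive eqV) r≤q) (≤-trans (≤-reflexive eqc) c≤q) q≤′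
    (≤-trans q≤ (≤-trans (#Q≤tri T al) (≤-reflexive (cong tri (sym eqV))))))
  where
  eqV : #V T′ + 0 ≡ #V T
  eqV = trans (+-identityʳ _) (same-#V {T = T′} from to)
  eqc : length T′ + 0 + (c* ∸ length T) ≡ c*
  eqc = trans (cong (_+ (c* ∸ length T)) (trans (+-identityʳ _) (length-≈ u′ u from to))) (m+[n∸m]≡n c≤)
  q≤′ : q* ≤ #Q T′ + 0 + (c* ∸ length T)
  q≤′ = ≤-trans q≤ (≤-trans (≤-reflexive (trans (same-#Q {T = T} to from) (sym (+-identityʳ _)))) (m≤m+n _ _))

-- Splitting a variable

-- An occurrence of z that can be given up: z remains in p or in another cubic.
Reusable : List (Mon n) → Set
Reusable {n} T = ∃ λ (z : Fin n) → ∃ λ p → z · p ∈ T × (z ∈ supp p ⊎ ∃ λ m → m ∈ T × m ≢ z · p × z ∈ supp m)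

-- Without such an occurrence the cubics would be squarefree with pairwise disjoint supports, which
-- makes three variables per cubic.
reusable : (T : List (Mon n)) → Cubics T → #V T < 3 * length T → Reusable T
reusable (m ∷ T) (u ∷ us , c ∷ al) lt with any? (λ z → z ∈ᵥ? V T) (supp m)
... | yes some with find some
...   | z , z∈m , z∈T with ∈-supp⁻ m z∈m | CV.∈-collect⁻ T z∈T
...     | p , refl | m′ , m′∈ , z∈m′ = z , p , here refl , inj₂ (m′ , there m′∈ , (λ { refl → All.All¬⇒¬Any u m′∈ }) , z∈m′)
reusable (m ∷ T) (u ∷ us , c ∷ al) lt | no none with sqfree? m
... | yes sq = weaken (reusable T (us , al) (+-cancelˡ-< 3 _ _ (≤-trans (≤-reflexive (cong suc (sym #V≡))) (≤-trans lt (≤-reflexive (*-suc 3 (length T)))))))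
  where
  #V≡ : #V (m ∷ T) ≡ 3 + #V T
  #V≡ = trans (CV.length-union-new λ p q → none (lose p q)) (cong (_+ #V T) sq)
  weaken : Reusable T → Reusable (m ∷ T)
  weaken (z , p , p∈ , inj₁ h) = z , p , there p∈ , inj₁ h
  weaken (z , p , p∈ , inj₂ (m′ , m′∈ , h)) = z , p , there p∈ , inj₂ (m′ , there m′∈ , h)
... | no ns with deg-3 m c
...   | x , y , z , refl with x Fin.≟ y | x Fin.≟ z | y Fin.≟ z
...     | yes refl | _ | _ = x , qd x z , here refl , inj₁ (∈-supp⁺ x _)
...     | no _ | yes refl | _ = x , qd y x , here refl , inj₁ (∈-supp-·⁺ʳ y _ (∈-supp⁺ x _))
...     | no _ | no _ | yes refl = y , qd x y , here (·-comm y x _) , inj₁ (∈-supp-·⁺ʳ x _ (∈-supp⁺ y _))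
...     | no x≢y | no x≢z | no y≢z = ⊥-elim (ns (≤-antisym (≤-trans (length-supp-≤ m) (≤-reflexive c))
            (length-⊆ {xs = x ∷ y ∷ z ∷ []} ((x≢y ∷ x≢z ∷ []) ∷ (y≢z ∷ []) ∷ [] ∷ []) sub)))
  where
  sub : x ∷ y ∷ z ∷ [] ⊆ supp (cb x y z)
  sub (here refl) = ∈-supp⁺ x _
  sub (there (here refl)) = ∈-supp-·⁺ʳ x _ (∈-supp⁺ y _)
  sub (there (there (here refl))) = ∈-supp-·⁺ʳ x _ (∈-supp-·⁺ʳ y _ (∈-supp⁺ z _))

#Q≤3#T : (T : List (Mon n)) → All Cubic T → #Q T ≤ 3 * length T
#Q≤3#T [] _ = z≤n
#Q≤3#T (m ∷ T) (c ∷ al) = ≤-trans (CQ.length-union-≤ (shad m) (Q T)) (≤-trans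
  (+-mono-≤ (≤-trans (≤-reflexive (length-shad m)) (≤-trans (length-supp-≤ m) (≤-reflexive c))) (#Q≤3#T T al))
  (≤-reflexive (sym (*-suc 3 (length T)))))

-- One occurrence of z in a cubic z p is replaced by a fresh variable.
split-variable : ∀ {r q c} → Realizable r q c → r < q → ∃ λ q′ → q ≤ q′ × Realizable (suc r) q′ c
split-variable (realize {n} T cs@(u , al) refl refl refl) r<q with reusable T cs (<-≤-trans r<q (#Q≤3#T T al))
... | z , p , zp∈ , reuse = #Q T⁺ , q≤ , realize T⁺ cs⁺ #V⁺ refl #T⁺
  where
  T₀ : List (Mon n)
  T₀ = filter (λ m → ¬? (m ≟ₘ (z · p))) T
  u₀ : Unique T₀
  u₀ = Unique.filter⁺ _ u
  T₀⊆T : T₀ ⊆ T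
  T₀⊆T q = proj₁ (∈-filter⁻ (λ m → ¬? (m ≟ₘ (z · p))) q)
  zp∉ : z · p ∉ T₀
  zp∉ q = proj₂ (∈-filter⁻ (λ m → ¬? (m ≟ₘ (z · p))) {xs = T} q) refl
  to : T ⊆ z · p ∷ T₀
  to {m} q with m ≟ₘ (z · p)
  ... | yes refl = here refl
  ... | no ne = there (∈-filter⁺ (λ m → ¬? (m ≟ₘ (z · p))) q ne)
  from : z · p ∷ T₀ ⊆ T
  from (here refl) = zp∈
  from (there q) = T₀⊆T q
  T⁺ : List (Mon (suc n))
  T⁺ = (1 ∷ p) ∷ lift T₀
  #T⁺ : length T⁺ ≡ length T
  #T⁺ = trans (cong suc (length-map _ T₀)) (length-≈ (unique-∷ zp∉ u₀) u from to)
  cs⁺ : Cubics T⁺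
  cs⁺ = cubics-∷ (cubics-lift (u₀ , All.tabulate (All.lookup al ∘ T₀⊆T))) (trans (sym (deg-· z p)) (All.lookup al zp∈)) new
    where
    new : 1 ∷ p ∉ lift T₀
    new q with ∈-map⁻ (0 ∷_) q
    ... | _ , _ , ()
  elsewhere : (∃ λ m → m ∈ T × m ≢ z · p × z ∈ supp m) → z ∈ V T₀
  elsewhere (m , m∈ , m≢ , q) = CV.∈-collect⁺ (∈-filter⁺ (λ m → ¬? (m ≟ₘ (z · p))) m∈ m≢) q
  #V⁺ : #V T⁺ ≡ suc (#V T)
  #V⁺ = trans (length-≈ (V-unique T⁺) (unique-∷ zero∉ (Unique.map⁺ Fin.suc-injective (V-unique T))) V⊆ V⊇) (cong suc (length-map suc (V T)))
    where
    zero∉ : zero ∉ map suc (V T)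
    zero∉ q with ∈-map⁻ suc q
    ... | _ , _ , ()
    V⊆ : V T⁺ ⊆ zero ∷ map suc (V T)
    V⊆ q with CV.∈-union⁻ {ds = supp (1 ∷ p)} q
    ... | inj₁ (here refl) = here refl
    ... | inj₁ (there s) with ∈-map⁻ suc s
    ...   | x , x∈ , refl = there (∈-map⁺ suc (CV.∈-collect⁺ zp∈ (∈-supp-·⁺ʳ z p x∈)))
    V⊆ q | inj₂ s with ∈-V-lift⁻ T₀ s
    ...   | x , x∈ , refl = there (∈-map⁺ suc (CV.collect-⊆ T₀⊆T x∈))
    old : ∀ {x} → x ∈ supp p ⊎ x ∈ V T₀ → suc x ∈ V T⁺
    old (inj₁ s) = CV.∈-union⁺ˡ {ds = supp (1 ∷ p)} {V (lift T₀)} (there (∈-map⁺ suc s))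
    old (inj₂ s) = CV.∈-union⁺ʳ {ds = supp (1 ∷ p)} (∈-V-lift⁺ {T = T₀} s)
    V⊇ : zero ∷ map suc (V T) ⊆ V T⁺
    V⊇ (here refl) = CV.∈-union⁺ˡ {ds = supp (1 ∷ p)} {V (lift T₀)} (here refl)
    V⊇ (there q) with ∈-map⁻ suc q
    ... | x , x∈ , refl with CV.∈-collect⁻ T x∈
    ...   | m , m∈ , x∈m with to m∈
    ...     | there m∈₀ = old (inj₂ (CV.∈-collect⁺ m∈₀ x∈m))
    ...     | here refl with ∈-supp-·⁻ z p x∈m
    ...       | inj₁ refl = old (Sum.map₂ elsewhere reuse)
    ...       | inj₂ s = old (inj₁ s)
  P : List (Mon n)
  P = CQ.union [ p ] (Q T₀)
  -- The old quadrics are p, those of the other cubics, and z times the linear divisors of p. The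
  -- first two kinds survive; in the third z turns into the fresh variable, so these stay distinct
  -- from each other and from the rest.
  q≤ : #Q T ≤ #Q T⁺
  q≤ = begin
    #Q T                                                      ≤⟨ length-⊆ (Q-unique T) Q⊆ ⟩
    length (P ++ map (z ·_) (shad p))                         ≡⟨ length-++ P ⟩
    length P + length (map (z ·_) (shad p))                   ≡⟨ cong₂ _+_ (sym (length-map (0 ∷_) P)) (trans (length-map _ (shad p)) (sym (length-map _ (shad p)))) ⟩
    length (lift P) + length (map (1 ∷_) (shad p))            ≡⟨ sym (length-++ (lift P)) ⟩
    length (lift P ++ map (1 ∷_) (shad p))                    ≤⟨ length-⊆ uniq ⊆Q ⟩
    #Q T⁺                                                     ∎
    where
    open ≤-Reasoning
    Q⊆ : Q T ⊆ P ++ map (z ·_) (shad p)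
    Q⊆ q with CQ.∈-collect⁻ T q
    ... | m , m∈ , d∈ with to m∈
    ...   | there m∈₀ = ∈-++⁺ˡ (CQ.∈-union⁺ʳ {ds = [ p ]} (CQ.∈-collect⁺ m∈₀ d∈))
    ...   | here refl with ∈-shad-·⁻ z p d∈
    ...     | inj₁ refl = ∈-++⁺ˡ (CQ.∈-union⁺ˡ {ds = [ p ]} {Q T₀} (here refl))
    ...     | inj₂ (d′ , d′∈ , refl) = ∈-++⁺ʳ P (∈-map⁺ (z ·_) d′∈)
    uniq : Unique (lift P ++ map (1 ∷_) (shad p))
    uniq = Unique.++⁺ (Unique.map⁺ Vec.∷-injectiveʳ (CQ.union-unique ([] ∷ []) (Q-unique T₀)))
      (Unique.map⁺ Vec.∷-injectiveʳ (shad-unique p)) dis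
      where
      dis : ∀ {d} → ¬ (d ∈ lift P × d ∈ map (1 ∷_) (shad p))
      dis (a , b) with ∈-map⁻ (0 ∷_) a | ∈-map⁻ (1 ∷_) b
      ... | _ , _ , refl | _ , _ , ()
    ⊆Q : lift P ++ map (1 ∷_) (shad p) ⊆ Q T⁺
    ⊆Q q with ∈-++⁻ (lift P) q
    ... | inj₂ s = CQ.∈-union⁺ˡ {ds = shad (1 ∷ p)} {Q (lift T₀)} (there s)
    ... | inj₁ s with ∈-map⁻ (0 ∷_) s
    ...   | d , d∈ , refl with CQ.∈-union⁻ {ds = [ p ]} d∈
    ...     | inj₁ (here refl) = CQ.∈-union⁺ˡ {ds = shad (1 ∷ p)} {Q (lift T₀)} (here refl)
    ...     | inj₂ t = CQ.∈-union⁺ʳ {ds = shad (1 ∷ p)} (∈-Q-lift⁺ {T = T₀} t)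

-- A split may increase the number of quadrics; `spread-region` brings it back to q with the
-- variables and cubics unchanged, which is where c ≤ q enters.
raise-vars : ∀ {r q c} k → Realizable r q c → c ≤ q → k + r ≤ q → Realizable (k + r) q c
raise-vars zero R _ _ = R
raise-vars (suc k) R c≤q le with split-variable (raise-vars k R c≤q (<⇒≤ le)) le
... | q′ , q≤q′ , R′ = spread-region R′ ≤-refl c≤q le q≤q′

-- Multiplicities and transpositions

δ : Fin n → Fin n → ℕ
δ w z = if does (w Fin.≟ z) then 1 else 0

δ-refl : (w : Fin n) → δ w w ≡ 1
δ-refl w rewrite dec-true (w Fin.≟ w) refl = refl

δ-≢ : {w z : Fin n} → w ≢ z → δ w z ≡ 0
δ-≢ {w = w} {z} ne rewrite dec-false (w Fin.≟ z) ne = refl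

lookup-· : ∀ (w : Fin n) m z → lookup (w · m) z ≡ δ w z + lookup m z
lookup-· zero (a ∷ m) zero = refl
lookup-· zero (a ∷ m) (suc z) = refl
lookup-· (suc w) (a ∷ m) zero = refl
lookup-· (suc w) (a ∷ m) (suc z) = lookup-· w m z

lookup-·-≢ : ∀ {w z : Fin n} m → w ≢ z → lookup (w · m) z ≡ lookup m z
lookup-·-≢ {w = w} {z} m ne = trans (lookup-· w m z) (cong (_+ lookup m z) (δ-≢ ne))

lookup-·-≡ : ∀ (z : Fin n) m → lookup (z · m) z ≡ suc (lookup m z)
lookup-·-≡ z m = trans (lookup-· z m z) (cong (_+ lookup m z) (δ-refl z))

·-cancelʳ : ∀ {x y : Fin n} m → x · m ≡ y · m → x ≡ y
·-cancelʳ {x = x} {y} m eq = decidable-stable (x Fin.≟ y) λ ne →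
  1+n≢n (trans (sym (lookup-·-≡ x m)) (trans (cong (λ w → lookup w x) eq) (lookup-·-≢ m (ne ∘ sym))))

lookup-ext : {m m′ : Mon n} → (∀ z → lookup m z ≡ lookup m′ z) → m ≡ m′
lookup-ext {m = m} {m′} h = trans (sym (Vec.tabulate∘lookup m)) (trans (Vec.tabulate-cong h) (Vec.tabulate∘lookup m′))

∈-supp⇒lookup : ∀ {z : Fin n} m → z ∈ supp m → 0 < lookup m z
∈-supp⇒lookup {z = z} m p with ∈-supp⁻ m p
... | m′ , refl = subst (0 <_) (sym (lookup-·-≡ z m′)) (s≤s z≤n)

lookup⇒∈-supp : ∀ {z : Fin n} m → 0 < lookup m z → z ∈ supp m
lookup⇒∈-supp {z = zero} (suc a ∷ m) _ = here refl
lookup⇒∈-supp {z = suc z} (zero ∷ m) p = ∈-map⁺ suc (lookup⇒∈-supp m p)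
lookup⇒∈-supp {z = suc z} (suc a ∷ m) p = there (∈-map⁺ suc (lookup⇒∈-supp m p))

lookup-shad : ∀ {d : Mon n} m z → d ∈ shad m → lookup d z ≤ lookup m z × lookup m z ≤ suc (lookup d z)
lookup-shad {d = d} m z p with ∈-shad⁻ m p
... | w , refl with w Fin.≟ z
...   | yes refl = ≤-trans (n≤1+n _) (≤-reflexive (sym (lookup-·-≡ w d))) , ≤-reflexive (lookup-·-≡ w d)
...   | no ne = ≤-reflexive (sym (lookup-·-≢ d ne)) , ≤-trans (≤-reflexive (lookup-·-≢ d ne)) (n≤1+n _)

unique-map-on : ∀ {f : A → B} {xs} → (∀ {a b} → a ∈ xs → b ∈ xs → f a ≡ f b → a ≡ b) → Unique xs → Unique (map f xs)
unique-map-on {xs = []} inj [] = []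
unique-map-on {f = f} {xs = x ∷ xs} inj (x∉ ∷ u) = unique-∷ new (unique-map-on (λ a b → inj (there a) (there b)) u)
  where
  new : f x ∉ map f xs
  new p with ∈-map⁻ f p
  ... | y , y∈ , eq = All.All¬⇒¬Any x∉ (subst (_∈ xs) (sym (inj (here refl) (there y∈) eq)) y∈)

-- The total multiplicity of y in the family, which is the termination measure for compressions.
weight : Fin n → List (Mon n) → ℕ
weight y [] = 0
weight y (m ∷ T) = lookup m y + weight y T

weight-mono : ∀ (y : Fin n) {f : Mon n → Mon n} T → (∀ m → lookup (f m) y ≤ lookup m y) → weight y (map f T) ≤ weight y T
weight-mono y [] h = z≤n
weight-mono y (m ∷ T) h = +-mono-≤ (h m) (weight-mono y T h)

weight-< : ∀ (y : Fin n) {f : Mon n → Mon n} {T m} → (∀ m → lookup (f m) y ≤ lookup m y) →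
  m ∈ T → lookup (f m) y < lookup m y → weight y (map f T) < weight y T
weight-< y {T = m ∷ T} h (here refl) lt = +-mono-≤ lt (weight-mono y T h)
weight-< y {T = m ∷ T} h (there p) lt = +-mono-≤-< (h m) (weight-< y h p lt)

-- Compression of a family from y towards x.

module Swap {n} (x y : Fin n) (x≢y : x ≢ y) where

  τ : Fin n → Fin n
  τ = transpose x y

  τ-x : τ x ≡ y
  τ-x rewrite dec-true (x Fin.≟ x) refl = refl

  τ-y : τ y ≡ x
  τ-y rewrite dec-false (y Fin.≟ x) (x≢y ∘ sym) | dec-true (y Fin.≟ y) refl = refl

  τ-≢ : ∀ {z} → z ≢ x → z ≢ y → τ z ≡ z
  τ-≢ {z} z≢x z≢y rewrite dec-false (z Fin.≟ x) z≢x | dec-false (z Fin.≟ y) z≢y = refl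

  τ-involutive : ∀ z → τ (τ z) ≡ z
  τ-involutive z = go (z Fin.≟ x) (z Fin.≟ y)
    where
    go : ∀ {z} → Dec (z ≡ x) → Dec (z ≡ y) → τ (τ z) ≡ z
    go (yes refl) _ = trans (cong τ τ-x) τ-y
    go (no _) (yes refl) = trans (cong τ τ-y) τ-x
    go (no p) (no q) = trans (cong τ (τ-≢ p q)) (τ-≢ p q)

  δ-τ : ∀ w z → δ (τ w) z ≡ δ w (τ z)
  δ-τ w z with w Fin.≟ τ z
  ... | yes refl = trans (cong (λ v → δ v z) (τ-involutive z)) (δ-refl z)
  ... | no ne = δ-≢ {w = τ w} {z} λ eq → ne (trans (sym (τ-involutive w)) (cong τ eq))

  σ : Mon n → Mon n
  σ m = tabulate (λ z → lookup m (τ z))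

  lookup-σ : ∀ m z → lookup (σ m) z ≡ lookup m (τ z)
  lookup-σ m z = Vec.lookup∘tabulate _ z

  lookup-σ-x : ∀ m → lookup (σ m) x ≡ lookup m y
  lookup-σ-x m = trans (lookup-σ m x) (cong (lookup m) τ-x)

  lookup-σ-y : ∀ m → lookup (σ m) y ≡ lookup m x
  lookup-σ-y m = trans (lookup-σ m y) (cong (lookup m) τ-y)

  σ-involutive : ∀ m → σ (σ m) ≡ m
  σ-involutive m = lookup-ext λ z → trans (lookup-σ (σ m) z) (trans (lookup-σ m (τ z)) (cong (lookup m) (τ-involutive z)))

  σ-injective : ∀ {m m′} → σ m ≡ σ m′ → m ≡ m′
  σ-injective {m} {m′} eq = trans (sym (σ-involutive m)) (trans (cong σ eq) (σ-involutive m′))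

  σ-· : ∀ w m → σ (w · m) ≡ τ w · σ m
  σ-· w m = lookup-ext λ z → begin
    lookup (σ (w · m)) z          ≡⟨ lookup-σ (w · m) z ⟩
    lookup (w · m) (τ z)          ≡⟨ lookup-· w m (τ z) ⟩
    δ w (τ z) + lookup m (τ z)    ≡⟨ cong₂ _+_ (sym (δ-τ w z)) (sym (lookup-σ m z)) ⟩
    δ (τ w) z + lookup (σ m) z    ≡⟨ sym (lookup-· (τ w) (σ m) z) ⟩
    lookup (τ w · σ m) z          ∎
    where open ≡-Reasoning

  σ-𝟙 : σ 𝟙 ≡ 𝟙
  σ-𝟙 = lookup-ext λ z → trans (lookup-σ 𝟙 z) (trans (Vec.lookup-replicate (τ z) 0) (sym (Vec.lookup-replicate z 0)))

  σ-cb : ∀ a b c → σ (cb a b c) ≡ cb (τ a) (τ b) (τ c)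
  σ-cb a b c = trans (σ-· a _) (cong (τ a ·_) (trans (σ-· b _) (cong (τ b ·_) (trans (σ-· c _) (cong (τ c ·_) σ-𝟙)))))

  σ-cubic : ∀ {m} → Cubic m → Cubic (σ m)
  σ-cubic {m} h with deg-3 m h
  ... | a , b , c , refl = trans (cong deg (σ-cb a b c)) (deg-cb (τ a) (τ b) (τ c))

  σ-shad : ∀ {d} m → d ∈ shad m → σ d ∈ shad (σ m)
  σ-shad {d} m p with ∈-shad⁻ m p
  ... | w , refl = subst (λ v → σ d ∈ shad v) (sym (σ-· w d)) (∈-shad⁺ (τ w) (σ d))

  Heavy : Mon n → Set
  Heavy m = lookup m x < lookup m y

  balanced : ∀ m → lookup m x ≡ lookup m y → σ m ≡ m
  balanced m eq = lookup-ext λ z → trans (lookup-σ m z) (go (z Fin.≟ x) (z Fin.≟ y))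
    where
    go : ∀ {z} → Dec (z ≡ x) → Dec (z ≡ y) → lookup m (τ z) ≡ lookup m z
    go (yes refl) _ = trans (cong (lookup m) τ-x) (sym eq)
    go (no _) (yes refl) = trans (cong (lookup m) τ-y) eq
    go (no p) (no q) = cong (lookup m) (τ-≢ p q)

  heavy-σ : ∀ m → Heavy m → lookup (σ m) y < lookup (σ m) x
  heavy-σ m = subst₂ _<_ (sym (lookup-σ-y m)) (sym (lookup-σ-x m))

  -- Dividing by one variable lowers the multiplicity of x by at most one, so at worst a strict
  -- inequality becomes weak.
  light-shad : ∀ {d} m → lookup m y < lookup m x → d ∈ shad m → lookup d y ≤ lookup d x
  light-shad m lt p = ≤-pred (≤-trans (s≤s (proj₁ (lookup-shad m y p))) (≤-trans lt (proj₂ (lookup-shad m x p))))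

  module _ (T : List (Mon n)) where

    Moves : Mon n → Set
    Moves m = Heavy m × σ m ∉ T

    moves? : ∀ m → Dec (Moves m)
    moves? m = (lookup m x ℕ.<? lookup m y) ×-dec ¬? (σ m ∈ₘ? T)

    -- A shifting operator in the sense of extremal set theory: a cubic with more y than x is
    -- replaced by its mirror image under exchange of x and y, unless that is already in `T`. The
    -- exception keeps `φ` injective on `T`.
    φ : Mon n → Mon n
    φ m with moves? m
    ... | yes _ = σ m
    ... | no _ = m

    φ-cases : ∀ m → (Moves m × φ m ≡ σ m) ⊎ (¬ Moves m × φ m ≡ m)
    φ-cases m with moves? m
    ... | yes p = inj₁ (p , refl)
    ... | no p = inj₂ (p , refl)

    φ-moves : ∀ m → Moves m → φ m ≡ σ m
    φ-moves m mv with φ-cases m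
    ... | inj₁ (_ , eq) = eq
    ... | inj₂ (nm , _) = ⊥-elim (nm mv)

    T↓ : List (Mon n)
    T↓ = map φ T

    ∈-T↓⁻ : ∀ {m} → m ∈ T↓ → (∃ λ m′ → m′ ∈ T × Moves m′ × m ≡ σ m′) ⊎ (m ∈ T × ¬ Moves m)
    ∈-T↓⁻ p with ∈-map⁻ φ p
    ... | m′ , m′∈ , refl with φ-cases m′
    ...   | inj₁ (mv , eq) = inj₁ (m′ , m′∈ , mv , eq)
    ...   | inj₂ (nm , eq) = inj₂ (subst (_∈ T) (sym eq) m′∈ , subst (¬_ ∘ Moves) (sym eq) nm)

    cubics-↓ : Cubics T → Cubics T↓
    cubics-↓ (u , al) = unique-map-on inj u , All.tabulate cub
      where
      inj : ∀ {a b} → a ∈ T → b ∈ T → φ a ≡ φ b → a ≡ b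
      inj {a} {b} a∈ b∈ eq with φ-cases a | φ-cases b
      ... | inj₁ (_ , ea) | inj₁ (_ , eb) = σ-injective (trans (sym ea) (trans eq eb))
      ... | inj₁ ((_ , σa∉) , ea) | inj₂ (_ , eb) = ⊥-elim (σa∉ (subst (_∈ T) (trans (sym eb) (trans (sym eq) ea)) b∈))
      ... | inj₂ (_ , ea) | inj₁ ((_ , σb∉) , eb) = ⊥-elim (σb∉ (subst (_∈ T) (trans (sym ea) (trans eq eb)) a∈))
      ... | inj₂ (_ , ea) | inj₂ (_ , eb) = trans (sym ea) (trans eq eb)
      cub : ∀ {m} → m ∈ T↓ → Cubic m
      cub p with ∈-T↓⁻ p
      ... | inj₁ (m′ , m′∈ , _ , refl) = σ-cubic {m′} (All.lookup al m′∈)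
      ... | inj₂ (m∈ , _) = All.lookup al m∈

    -- A new quadric e comes from a moved cubic, so it contains x more often than y. Its mirror
    -- image could then survive only in an unmoved cubic whose mirror image lies in T as well,
    -- but that makes e old.
    no-clash : ∀ {e} → e ∈ Q T↓ → e ∉ Q T → σ e ∈ Q T↓ → σ e ∈ Q T → ⊥
    no-clash {e} p e∉ q σe∈ with CQ.∈-collect⁻ T↓ p
    ... | m , m∈ , e∈m with ∈-T↓⁻ m∈
    ...   | inj₂ (m∈T , _) = e∉ (CQ.∈-collect⁺ m∈T e∈m)
    ...   | inj₁ (m′ , _ , (hv , _) , refl) with CQ.∈-collect⁻ T↓ q
    ...     | m₁ , m₁∈ , σe∈m₁ = contra (∈-T↓⁻ m₁∈)
      where
      e-light : lookup e y < lookup e x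
      e-light = ≤∧≢⇒< (light-shad (σ m′) (heavy-σ m′ hv) e∈m) λ eq → e∉ (subst (_∈ Q T) (balanced e (sym eq)) σe∈)
      σe-heavy : Heavy (σ e)
      σe-heavy = subst₂ _<_ (sym (lookup-σ-x e)) (sym (lookup-σ-y e)) e-light
      e∈σm₁ : e ∈ shad (σ m₁)
      e∈σm₁ = subst (_∈ shad (σ m₁)) (σ-involutive e) (σ-shad m₁ σe∈m₁)
      contra : (∃ λ m′ → m′ ∈ T × Moves m′ × m₁ ≡ σ m′) ⊎ (m₁ ∈ T × ¬ Moves m₁) → ⊥
      contra (inj₁ (m₂ , _ , (hv₂ , _) , refl)) = <⇒≱ σe-heavy (light-shad (σ m₂) (heavy-σ m₂ hv₂) σe∈m₁)
      contra (inj₂ (m₁∈T , nm)) with <-cmp (lookup m₁ x) (lookup m₁ y)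
      ... | tri< lt _ _ = nm (lt , λ σm₁∈ → e∉ (CQ.∈-collect⁺ σm₁∈ e∈σm₁))
      ... | tri≈ _ eq _ = e∉ (CQ.∈-collect⁺ m₁∈T (subst (λ v → e ∈ shad v) (balanced m₁ eq) e∈σm₁))
      ... | tri> _ _ gt = <⇒≱ σe-heavy (light-shad m₁ gt σe∈m₁)

    -- Old quadrics are sent to themselves and new ones to their mirror images, which lie in `Q T`.
    -- By `no-clash` the images are distinct.
    #Q-↓ : #Q T↓ ≤ #Q T
    #Q-↓ = ≤-trans (≤-reflexive (sym (length-map ψ (Q T↓)))) (length-⊆ (unique-map-on inj (Q-unique T↓)) sub)
      where
      ψ : Mon n → Mon n
      ψ d with d ∈ₘ? Q T
      ... | yes _ = d
      ... | no _ = σ d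
      inj : ∀ {a b} → a ∈ Q T↓ → b ∈ Q T↓ → ψ a ≡ ψ b → a ≡ b
      inj {a} {b} a∈ b∈ eq with a ∈ₘ? Q T | b ∈ₘ? Q T
      ... | yes _ | yes _ = eq
      ... | no _ | no _ = σ-injective eq
      ... | yes p | no q = ⊥-elim (no-clash b∈ q (subst (_∈ Q T↓) eq a∈) (subst (_∈ Q T) eq p))
      ... | no q | yes p = ⊥-elim (no-clash a∈ q (subst (_∈ Q T↓) (sym eq) b∈) (subst (_∈ Q T) (sym eq) p))
      into : ∀ {d} → d ∈ Q T↓ → ψ d ∈ Q T
      into {d} p with d ∈ₘ? Q T
      ... | yes q = q
      ... | no d∉ with CQ.∈-collect⁻ T↓ p
      ...   | m , m∈ , d∈ with ∈-T↓⁻ m∈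
      ...     | inj₂ (m∈T , _) = ⊥-elim (d∉ (CQ.∈-collect⁺ m∈T d∈))
      ...     | inj₁ (m′ , m′∈ , _ , refl) = CQ.∈-collect⁺ m′∈ (subst (λ v → σ d ∈ shad v) (σ-involutive m′) (σ-shad (σ m′) d∈))
      sub : map ψ (Q T↓) ⊆ Q T
      sub p with ∈-map⁻ ψ p
      ... | d , d∈ , refl = into d∈

    -- A moved cubic contains y, so its mirror image contains x, and the variables other than x and
    -- y stay. Hence only y can be lost.
    V-↓⁺ : ∀ {z} → z ≢ y → z ∈ V T → z ∈ V T↓
    V-↓⁺ {z} z≢y p with CV.∈-collect⁻ T p
    ... | m , m∈ , z∈ = CV.∈-collect⁺ (∈-map⁺ φ m∈) (go (φ-cases m))
      where
      go : (Moves m × φ m ≡ σ m) ⊎ (¬ Moves m × φ m ≡ m) → z ∈ supp (φ m)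
      go (inj₂ (_ , eq)) = subst (λ v → z ∈ supp v) (sym eq) z∈
      go (inj₁ ((hv , _) , eq)) = subst (λ v → z ∈ supp v) (sym eq) (lookup⇒∈-supp (σ m) pos)
        where
        pos : 0 < lookup (σ m) z
        pos with z Fin.≟ x
        ... | yes refl = subst (0 <_) (sym (lookup-σ-x m)) (≤-<-trans z≤n hv)
        ... | no z≢x = subst (0 <_) (sym (trans (lookup-σ m z) (cong (lookup m) (τ-≢ z≢x z≢y)))) (∈-supp⇒lookup m z∈)

    V-↓⁻ : x ∈ V T → V T↓ ⊆ V T
    V-↓⁻ x∈ {z} p with CV.∈-collect⁻ T↓ p
    ... | m , m∈ , z∈ with ∈-T↓⁻ m∈
    ...   | inj₂ (m∈T , _) = CV.∈-collect⁺ m∈T z∈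
    ...   | inj₁ (m′ , m′∈ , (hv , _) , refl) with z Fin.≟ x | z Fin.≟ y
    ...     | yes refl | _ = x∈
    ...     | no _ | yes refl = CV.∈-collect⁺ m′∈ (lookup⇒∈-supp m′ (≤-<-trans z≤n hv))
    ...     | no z≢x | no z≢y = CV.∈-collect⁺ m′∈ (lookup⇒∈-supp m′
                (subst (0 <_) (trans (lookup-σ m′ z) (cong (lookup m′) (τ-≢ z≢x z≢y))) (∈-supp⇒lookup (σ m′) z∈)))

    weight-↓ : ∀ {m} → m ∈ T → Moves m → weight y T↓ < weight y T
    weight-↓ {m} m∈ mv@(hv , _) = weight-< y le m∈ (subst (λ v → lookup v y < lookup m y) (sym (φ-moves m mv)) (subst (_< lookup m y) (sym (lookup-σ-y m)) hv))
      where
      le : ∀ m → lookup (φ m) y ≤ lookup m y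
      le m with φ-cases m
      ... | inj₂ (_ , eq) = ≤-reflexive (cong (λ v → lookup v y) eq)
      ... | inj₁ ((hv , _) , eq) = ≤-trans (≤-reflexive (trans (cong (λ v → lookup v y) eq) (lookup-σ-y m))) (<⇒≤ hv)

-- Compressing a variable away

Stable : Fin n → List (Mon n) → Set
Stable y T = ∀ {x} → x ∈ V T → (x≢y : x ≢ y) → ∀ {m} → m ∈ T → lookup m x < lookup m y → Swap.σ x y x≢y m ∈ T

Unstable : Fin n → List (Mon n) → Set
Unstable {n} y T = Σ (Fin n) λ x → x ∈ V T × Σ (x ≢ y) λ x≢y → ∃ λ m → m ∈ T × Swap.Moves x y x≢y T m

stable? : ∀ (y : Fin n) T → Unstable y T ⊎ Stable y T
stable? y T = go (V T) id
  where
  go : ∀ xs → xs ⊆ V T → Unstable y T ⊎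
    (∀ {x} → x ∈ xs → (x≢y : x ≢ y) → ∀ {m} → m ∈ T → lookup m x < lookup m y → Swap.σ x y x≢y m ∈ T)
  go [] _ = inj₂ λ ()
  go (x ∷ xs) sub with x Fin.≟ y | go xs (sub ∘ there)
  ... | _ | inj₁ un = inj₁ un
  ... | yes refl | inj₂ st = inj₂ λ { (here refl) x≢x → ⊥-elim (x≢x refl) ; (there p) → st p }
  ... | no x≢y | inj₂ st with any? (Swap.moves? x y x≢y T) T
  ...   | yes some with find some
  ...     | m , m∈ , mv = inj₁ (x , sub (here refl) , x≢y , m , m∈ , mv)
  go (x ∷ xs) sub | no x≢y | inj₂ st | no none = inj₂ λ
    { (here refl) x≢y′ {m} m∈ hv → decidable-stable (_ ∈ₘ? T) λ σm∉ → none (lose m∈ (hv , σm∉))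
    ; (there p) → st p }

record Compressed (y : Fin n) (T : List (Mon n)) : Set where
  field
    T′ : List (Mon n)
    cubics : Cubics T′
    length≡ : length T′ ≡ length T
    #Q≤ : #Q T′ ≤ #Q T
    V⊆ : V T′ ⊆ V T
    V⊇ : ∀ {z} → z ≢ y → z ∈ V T → z ∈ V T′
    stable : Stable y T′

-- Every compression that moves a cubic lowers the weight of y, so repeated compression towards the
-- other variables ends in a stable family.
compress : ∀ (y : Fin n) T → Cubics T → Acc _<_ (weight y T) → Compressed y T
compress y T cs (acc rec) with stable? y T
... | inj₂ st = record { T′ = T ; cubics = cs ; length≡ = refl ; #Q≤ = ≤-refl ; V⊆ = id ; V⊇ = λ _ → id ; stable = st }
... | inj₁ (x , x∈ , x≢y , m , m∈ , mv) = record
  { T′ = C.T′ ; cubics = C.cubics ; length≡ = trans C.length≡ (length-map _ T) ; #Q≤ = ≤-trans C.#Q≤ (#Q-↓ T)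
  ; V⊆ = V-↓⁻ T x∈ ∘ C.V⊆ ; V⊇ = λ z≢y z∈ → C.V⊇ z≢y (V-↓⁺ T z≢y z∈) ; stable = C.stable }
  where
  open Swap x y x≢y
  module C = Compressed (compress y (T↓ T) (cubics-↓ T cs) (rec (weight-↓ T m∈ mv)))

-- Deleting a variable from a stable family.

length-cartesianProduct : (xs : List A) (ys : List B) → length (cartesianProduct xs ys) ≡ length xs * length ys
length-cartesianProduct [] ys = refl
length-cartesianProduct (x ∷ xs) ys = trans (length-++ (map (x ,_) ys)) (cong₂ _+_ (length-map _ ys) (length-cartesianProduct xs ys))

take-⊆ : ∀ k (xs : List A) → take k xs ⊆ xs
take-⊆ k xs p = subst (_ ∈_) (take++drop≡id k xs) (∈-++⁺ˡ p)

length-filter-split : ∀ {P : A → Set} (P? : ∀ x → Dec (P x)) xs → Unique xs →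
  length xs ≤ length (filter (¬? ∘ P?) xs) + length (filter P? xs)
length-filter-split P? xs u = ≤-trans (length-⊆ u sub) (≤-reflexive (length-++ (filter (¬? ∘ P?) xs)))
  where
  sub : xs ⊆ filter (¬? ∘ P?) xs ++ filter P? xs
  sub {x} p with P? x
  ... | yes px = ∈-++⁺ʳ (filter (¬? ∘ P?) xs) (∈-filter⁺ P? p px)
  ... | no ¬px = ∈-++⁺ˡ (∈-filter⁺ (¬? ∘ P?) p ¬px)

-- The value y is junk, for d = 1 only.
first : Fin n → Mon n → Fin n
first y d with supp d
... | [] = y
... | x ∷ _ = x

first-∈ : ∀ (y x : Fin n) m → first y (x · m) ∈ supp (x · m)
first-∈ y x m with supp (x · m) | ∈-supp⁺ x m
... | z ∷ _ | _ = here refl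

first-qd : ∀ (y : Fin n) {d} → deg d ≡ 2 → ∃ λ b → d ≡ qd (first y d) b
first-qd y {d} h with deg-suc d h
... | x , m , refl , _ with ∈-supp⁻ d (first-∈ y x m)
...   | m′ , eq with deg-1 m′ (suc-injective (trans (sym (deg-· (first y (x · m)) m′)) (trans (cong deg (sym eq)) h)))
...     | b , refl = b , eq

pair∈Q : ∀ {T : List (Mon n)} {m y z} → All Cubic T → m ∈ T → y ∈ supp m → z ∈ supp m → y ≢ z → qd y z ∈ Q T
pair∈Q {T = T} {m} {y} {z} al m∈ y∈ z∈ y≢z with ∈-supp⁻ m y∈
... | m′ , refl with ∈-supp-·⁻ y m′ z∈
...   | inj₁ refl = ⊥-elim (y≢z refl)
...   | inj₂ z∈′ with ∈-supp⁻ m′ z∈′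
...     | m″ , refl with deg-1 m″ (suc-injective (suc-injective (trans (sym (trans (deg-· y m′) (cong suc (deg-· z m″)))) (All.lookup al m∈))))
...       | w , refl = CQ.∈-collect⁺ m∈ (xy∈cb y z w)

-- With u running over the neighbours of y (those u with yu ∈ Q), stability makes every
-- u ≠ y a neighbour of all other variables. So each quadric d ∉ Q not involving y, once
-- added, makes all the cubics du available (d times one of its variables in place of dy,
-- as all squares are in Q if y² is). Trading the quadrics at y for as many new ones
-- therefore does not lose cubics.
module Delete {n} (y : Fin n) (T : List (Mon n)) (cs : Cubics T) (y∈V : y ∈ V T) (stable : Stable y T) where
  al = proj₂ cs

  V₀ : List (Fin n)
  V₀ = filter (λ z → ¬? (z Fin.≟ y)) (V T)

  ∈-V₀⁻ : ∀ {z} → z ∈ V₀ → z ∈ V T × z ≢ y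
  ∈-V₀⁻ = ∈-filter⁻ (λ z → ¬? (z Fin.≟ y))

  ∈-V₀⁺ : ∀ {z} → z ∈ V T → z ≢ y → z ∈ V₀
  ∈-V₀⁺ = ∈-filter⁺ (λ z → ¬? (z Fin.≟ y))

  V₀-unique : Unique V₀
  V₀-unique = Unique.filter⁺ _ (V-unique T)

  #V₀ : suc (length V₀) ≡ #V T
  #V₀ = length-≈ (unique-∷ (λ p → proj₂ (∈-V₀⁻ p) refl) V₀-unique) (V-unique T)
    (λ { (here refl) → y∈V ; (there p) → proj₁ (∈-V₀⁻ p) }) sub
    where
    sub : V T ⊆ y ∷ V₀
    sub {z} p with z Fin.≟ y
    ... | yes refl = here refl
    ... | no ne = there (∈-V₀⁺ p ne)

  nbr? : ∀ u → Dec (qd y u ∈ Q T)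
  nbr? u = qd y u ∈ₘ? Q T

  N : List (Fin n)
  N = filter nbr? (V T)

  ∈-N⁻ : ∀ {u} → u ∈ N → u ∈ V T × qd y u ∈ Q T
  ∈-N⁻ = ∈-filter⁻ nbr?

  ∈-N⁺ : ∀ {u} → qd y u ∈ Q T → u ∈ N
  ∈-N⁺ {u} p = ∈-filter⁺ nbr? (supp-Q T p (∈-supp-·⁺ʳ y _ (∈-supp⁺ u _))) p

  N-unique : Unique N
  N-unique = Unique.filter⁺ nbr? (V-unique T)

  k : ℕ
  k = length N

  -- Some cubic vyu lies in `T`. If v = x, it contains xu. Otherwise x does not divide it, and
  -- stability exchanges y for x, which gives a cubic in `T` that contains xu.
  universal : ∀ {u x} → u ∈ N → u ≢ y → x ∈ V T → x ≢ y → x ≢ u → qd x u ∈ Q T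
  universal {u} {x} u∈ u≢y x∈ x≢y x≢u with CQ.∈-collect⁻ T (proj₂ (∈-N⁻ u∈))
  ... | m , m∈ , d∈ with ∈-shad⁻ m d∈
  ...   | v , refl with v Fin.≟ x
  ...     | yes refl = CQ.∈-collect⁺ m∈ (xz∈cb x y u)
  ...     | no v≢x = CQ.∈-collect⁺ (stable x∈ x≢y m∈ heavy) (subst (λ w → qd x u ∈ shad w) (sym eq) (yz∈cb (τ v) x u))
    where
    open Swap x y x≢y
    x∉ : lookup (cb v y u) x ≡ 0
    x∉ = trans (lookup-·-≢ (qd y u) v≢x) (trans (lookup-·-≢ (u · 𝟙) (x≢y ∘ sym))
      (trans (lookup-·-≢ 𝟙 (x≢u ∘ sym)) (Vec.lookup-replicate x 0)))
    heavy : lookup (cb v y u) x < lookup (cb v y u) y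
    heavy = subst (_< lookup (cb v y u) y) (sym x∉) (∈-supp⇒lookup (cb v y u) (∈-supp-·⁺ʳ v _ (∈-supp⁺ y _)))
    eq : σ (cb v y u) ≡ cb (τ v) x u
    eq = trans (σ-cb v y u) (cong₂ (cb (τ v)) τ-y (τ-≢ (x≢u ∘ sym) u≢y))

  -- Some cubic vy² lies in `T`. For x ≠ y it contains y at least twice and x at most once, so
  -- stability puts its mirror image into `T`, and x² divides that.
  squares : y ∈ N → ∀ {x} → x ∈ V T → qd x x ∈ Q T
  squares y∈ {x} x∈ with x Fin.≟ y
  ... | yes refl = proj₂ (∈-N⁻ y∈)
  ... | no x≢y with CQ.∈-collect⁻ T (proj₂ (∈-N⁻ y∈))
  ...   | m , m∈ , d∈ with ∈-shad⁻ m d∈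
  ...     | v , refl = CQ.∈-collect⁺ (stable x∈ x≢y m∈ heavy) (subst (λ w → qd x x ∈ shad w) (sym eq) (yz∈cb (τ v) x x))
    where
    open Swap x y x≢y
    le : lookup (cb v y y) x ≤ 1
    le = ≤-trans (proj₂ (lookup-shad (cb v y y) x (yz∈cb v y y))) (s≤s (≤-reflexive
      (trans (lookup-·-≢ (y · 𝟙) (x≢y ∘ sym)) (trans (lookup-·-≢ 𝟙 (x≢y ∘ sym)) (Vec.lookup-replicate x 0)))))
    ge : 2 ≤ lookup (cb v y y) y
    ge = ≤-trans (≤-reflexive (sym (trans (lookup-·-≡ y (y · 𝟙)) (cong suc (trans (lookup-·-≡ y 𝟙) (cong suc (Vec.lookup-replicate y 0)))))))
      (proj₁ (lookup-shad (cb v y y) y (yz∈cb v y y)))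
    heavy : lookup (cb v y y) x < lookup (cb v y y) y
    heavy = ≤-trans (s≤s le) ge
    eq : σ (cb v y y) ≡ cb (τ v) x x
    eq = trans (σ-cb v y y) (cong₂ (cb (τ v)) τ-y τ-y)

  has-y? : (m : Mon n) → Dec (y ∈ supp m)
  has-y? m = y ∈ᵥ? supp m

  T₀ Tʸ : List (Mon n)
  T₀ = filter (¬? ∘ has-y?) T
  Tʸ = filter has-y? T

  ∈-T₀⁻ : ∀ {m} → m ∈ T₀ → m ∈ T × y ∉ supp m
  ∈-T₀⁻ = ∈-filter⁻ (¬? ∘ has-y?)

  -- A cubic through y is yuv with u and v neighbours of y. Counting ordered pairs is generous, but
  -- k² is just what k new quadrics with k cubics each will compensate.
  #Tʸ : length Tʸ ≤ k * k
  #Tʸ = ≤-trans (length-⊆ (Unique.filter⁺ has-y? (proj₁ cs)) sub)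
    (≤-reflexive (trans (length-map _ (cartesianProduct N N)) (length-cartesianProduct N N)))
    where
    sub : Tʸ ⊆ map (uncurry (cb y)) (cartesianProduct N N)
    sub {m} p with ∈-filter⁻ has-y? {xs = T} p
    ... | m∈ , y∈ with ∈-supp⁻ m y∈
    ...   | m′ , refl with deg-2 m′ (suc-injective (trans (sym (deg-· y m′)) (All.lookup al m∈)))
    ...     | u , v , refl = ∈-map⁺ (uncurry (cb y)) (∈-cartesianProduct⁺
                (∈-N⁺ (CQ.∈-collect⁺ m∈ (xy∈cb y u v))) (∈-N⁺ (CQ.∈-collect⁺ m∈ (xz∈cb y u v))))

  Q₀ : List (Mon n)
  Q₀ = filter (¬? ∘ has-y?) (Q T)

  #Q₀ : length Q₀ + k ≤ #Q T
  #Q₀ = ≤-trans (≤-reflexive (sym (trans (length-++ Q₀) (cong (length Q₀ +_) (length-map (qd y) N)))))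
    (length-⊆ (Unique.++⁺ (Unique.filter⁺ _ (Q-unique T)) (Unique.map⁺ (λ {a} {b} → qd-injectiveʳ y a b) N-unique) dis) sub)
    where
    dis : ∀ {d} → ¬ (d ∈ Q₀ × d ∈ map (qd y) N)
    dis (p , q) with ∈-map⁻ (qd y) q
    ... | u , _ , refl = proj₂ (∈-filter⁻ (¬? ∘ has-y?) {xs = Q T} p) (∈-supp⁺ y _)
    sub : Q₀ ++ map (qd y) N ⊆ Q T
    sub p with ∈-++⁻ Q₀ p
    ... | inj₁ q = proj₁ (∈-filter⁻ (¬? ∘ has-y?) q)
    ... | inj₂ q with ∈-map⁻ (qd y) q
    ...   | u , u∈ , refl = proj₂ (∈-N⁻ u∈)

  M : List (Mon n)
  M = filter (λ d → ¬? (d ∈ₘ? Q T)) (pairs V₀)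

  ∈-M⁻ : ∀ {d} → d ∈ M → d ∈ pairs V₀ × d ∉ Q T
  ∈-M⁻ = ∈-filter⁻ (λ d → ¬? (d ∈ₘ? Q T))

  module _ (enough : #Q T ≤ tri (length V₀)) where

    -- Provides a replacement for each of the k quadrics at y.
    k≤#M : k ≤ length M
    k≤#M = +-cancelˡ-≤ (length Q₀) _ _ (begin
      length Q₀ + k           ≤⟨ #Q₀ ⟩
      #Q T                    ≤⟨ enough ⟩
      tri (length V₀)         ≡⟨ sym (length-pairs V₀) ⟩
      length (pairs V₀)       ≤⟨ length-⊆ (pairs-unique V₀-unique) sub ⟩
      length (Q₀ ++ M)        ≡⟨ length-++ Q₀ ⟩
      length Q₀ + length M    ∎)
      where
      open ≤-Reasoning
      sub : pairs V₀ ⊆ Q₀ ++ M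
      sub {d} p with d ∈ₘ? Q T
      ... | no d∉ = ∈-++⁺ʳ Q₀ (∈-filter⁺ (λ d → ¬? (d ∈ₘ? Q T)) p d∉)
      ... | yes d∈ = ∈-++⁺ˡ (∈-filter⁺ (¬? ∘ has-y?) d∈ y∉)
        where
        y∉ : y ∉ supp d
        y∉ q with ∈-pairs⁻ V₀ p
        ... | a , b , a∈ , b∈ , refl with ∈-supp-qd⁻ a b q
        ...   | inj₁ refl = proj₂ (∈-V₀⁻ a∈) refl
        ...   | inj₂ refl = proj₂ (∈-V₀⁻ b∈) refl

    M′ : List (Mon n)
    M′ = take k M

    #M′ : length M′ ≡ k
    #M′ = trans (length-take k M) (m≤n⇒m⊓n≡m k≤#M)

    g : Mon n → Fin n → Mon n
    g d u with u Fin.≟ y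
    ... | yes _ = first y d · d
    ... | no _ = u · d

    missing : ∀ {d} → d ∈ M → ∃ λ b → d ≡ qd (first y d) b × first y d ∈ V₀ × b ∈ V₀
    missing {d} p with ∈-pairs⁻ V₀ (proj₁ (∈-M⁻ p))
    ... | a , b , a∈ , b∈ , eq with first-qd y {d} (trans (cong deg eq) (deg-qd a b))
    ...   | c , eq′ = c , eq′ , mem (subst (λ w → first y d ∈ supp w) (sym eq′) (∈-supp⁺ _ _))
                    , mem (subst (λ w → c ∈ supp w) (sym eq′) (∈-supp-·⁺ʳ (first y d) _ (∈-supp⁺ c _)))
      where
      mem : ∀ {z} → z ∈ supp d → z ∈ V₀
      mem q with ∈-supp-qd⁻ a b (subst (λ w → _ ∈ supp w) eq q)
      ... | inj₁ refl = a∈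
      ... | inj₂ refl = b∈

    -- By `universal` a neighbour u ≠ y of y forms a present quadric with every variable other than
    -- y and u, so the only quadric at u that can be missing away from y is u².
    square-only : ∀ u b → qd u b ∉ Q T → u ∈ N → u ≢ y → b ∈ V₀ → b ≡ u
    square-only u b ∉Q u∈ u≢y b∈ = decidable-stable (b Fin.≟ u) λ b≢u →
      ∉Q (subst (_∈ Q T) (qd-comm b u) (universal u∈ u≢y (proj₁ (∈-V₀⁻ b∈)) (proj₂ (∈-V₀⁻ b∈)) b≢u))

    edge : ∀ u a b → qd a b ∉ Q T → u ∈ N → u ≢ y → a ∈ V₀ → b ∈ V₀ → qd u a ≡ qd a b ⊎ qd u a ∈ Q T
    edge u a b ∉Q u∈ u≢y a∈ b∈ with a Fin.≟ u
    ... | yes refl = inj₁ (cong (qd u) (sym (square-only u b ∉Q u∈ u≢y b∈)))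
    ... | no a≢u = inj₂ (subst (_∈ Q T) (qd-comm a u) (universal u∈ u≢y (proj₁ (∈-V₀⁻ a∈)) (proj₂ (∈-V₀⁻ a∈)) a≢u))

    g-cases : ∀ d u → (u ≡ y × g d u ≡ first y d · d) ⊎ (u ≢ y × g d u ≡ u · d)
    g-cases d u with u Fin.≟ y
    ... | yes eq = inj₁ (eq , refl)
    ... | no ne = inj₂ (ne , refl)

    shad-aab : ∀ a b {e} → y ∈ N → a ∈ V₀ → e ∈ shad (cb a a b) → e ≡ qd a b ⊎ e ∈ Q T
    shad-aab a b y∈ a∈ e∈ with xxy-shad a b e∈
    ... | inj₁ p = inj₁ p
    ... | inj₂ p = inj₂ (subst (_∈ Q T) (sym p) (squares y∈ (proj₁ (∈-V₀⁻ a∈))))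

    shad-uab : ∀ u a b {e} → qd a b ∉ Q T → u ∈ N → u ≢ y → a ∈ V₀ → b ∈ V₀ → e ∈ shad (cb u a b) → e ≡ qd a b ⊎ e ∈ Q T
    shad-uab u a b ∉Q u∈ u≢y a∈ b∈ e∈ with ∈-shad-cb⁻ u a b e∈
    ... | inj₁ p = inj₁ p
    ... | inj₂ (inj₁ p) = Sum.map (λ q → trans p (trans q (qd-comm b a))) (subst (_∈ Q T) (sym p))
            (edge u b a (λ q → ∉Q (subst (_∈ Q T) (qd-comm b a) q)) u∈ u≢y b∈ a∈)
    ... | inj₂ (inj₂ p) = Sum.map (trans p) (subst (_∈ Q T) (sym p)) (edge u a b ∉Q u∈ u≢y a∈ b∈)

    g-shad : ∀ {d u e} → d ∈ M → u ∈ N → e ∈ shad (g d u) → e ≡ d ⊎ e ∈ Q T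
    g-shad {d} {u} {e} d∈ u∈ e∈ = go (missing d∈) (g-cases d u)
      where
      go : (∃ λ b → d ≡ qd (first y d) b × first y d ∈ V₀ × b ∈ V₀) →
        (u ≡ y × g d u ≡ first y d · d) ⊎ (u ≢ y × g d u ≡ u · d) → e ≡ d ⊎ e ∈ Q T
      go (b , eq , a∈ , b∈) (inj₁ (u≡y , eq′)) = Sum.map₁ (λ p → trans p (sym eq))
        (shad-aab (first y d) b (subst (_∈ N) u≡y u∈) a∈ (subst (λ w → e ∈ shad w) (trans eq′ (cong (first y d ·_) eq)) e∈))
      go (b , eq , a∈ , b∈) (inj₂ (u≢y , eq′)) = Sum.map₁ (λ p → trans p (sym eq))
        (shad-uab u (first y d) b (λ q → proj₂ (∈-M⁻ d∈) (subst (_∈ Q T) (sym eq) q)) u∈ u≢y a∈ b∈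
          (subst (λ w → e ∈ shad w) (trans eq′ (cong (u ·_) eq)) e∈))

    d∈g : ∀ d u → d ∈ shad (g d u)
    d∈g d u with u Fin.≟ y
    ... | yes _ = ∈-shad⁺ (first y d) d
    ... | no _ = ∈-shad⁺ u d

    g-cubic : ∀ {d} u → d ∈ M → Cubic (g d u)
    g-cubic {d} u d∈ = go (missing d∈) (∈-shad⁻ (g d u) (d∈g d u))
      where
      go : (∃ λ b → d ≡ qd (first y d) b × first y d ∈ V₀ × b ∈ V₀) → (∃ λ w → g d u ≡ w · d) → Cubic (g d u)
      go (b , eq , _) (w , eq′) = trans (cong deg eq′) (trans (deg-· w d) (cong suc (trans (cong deg eq) (deg-qd (first y d) b))))

    g-supp : ∀ {d u} → d ∈ M → u ∈ N → supp (g d u) ⊆ V₀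
    g-supp {d} {u} d∈ u∈ {z} p = go (missing d∈) (g-cases d u)
      where
      go : (∃ λ b → d ≡ qd (first y d) b × first y d ∈ V₀ × b ∈ V₀) →
        (u ≡ y × g d u ≡ first y d · d) ⊎ (u ≢ y × g d u ≡ u · d) → z ∈ V₀
      go (b , eq , a∈ , b∈) (inj₁ (_ , eq′)) = supp-cb⊆ a∈ a∈ b∈
        (subst (λ w → z ∈ supp w) (trans eq′ (cong (first y d ·_) eq)) p)
      go (b , eq , a∈ , b∈) (inj₂ (u≢y , eq′)) = supp-cb⊆ (∈-V₀⁺ (proj₁ (∈-N⁻ u∈)) u≢y) a∈ b∈
        (subst (λ w → z ∈ supp w) (trans eq′ (cong (u ·_) eq)) p)

    -- If the first variable a of d were a neighbour, `square-only` would give d = a², but all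
    -- squares are present when y² is. Hence the stand-in a d for d y differs from every u d with u
    -- a neighbour other than y.
    first∉N : ∀ {d} → d ∈ M → y ∈ N → first y d ∉ N
    first∉N {d} d∈ y∈ a∈N = go (missing d∈)
      where
      go : ¬ (∃ λ b → d ≡ qd (first y d) b × first y d ∈ V₀ × b ∈ V₀)
      go (b , eq , a∈ , b∈) = ∉Q (subst (λ w → qd (first y d) w ∈ Q T)
        (sym (square-only (first y d) b ∉Q a∈N (proj₂ (∈-V₀⁻ a∈)) b∈)) (squares y∈ (proj₁ (∈-V₀⁻ a∈))))
        where
        ∉Q : qd (first y d) b ∉ Q T
        ∉Q q = proj₂ (∈-M⁻ d∈) (subst (_∈ Q T) (sym eq) q)

    g-injectiveʳ : ∀ {d u u′} → d ∈ M → u ∈ N → u′ ∈ N → g d u ≡ g d u′ → u ≡ u′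
    g-injectiveʳ {d} {u} {u′} d∈ u∈ u′∈ eq with g-cases d u | g-cases d u′
    ... | inj₁ (u≡y , _) | inj₁ (u′≡y , _) = trans u≡y (sym u′≡y)
    ... | inj₂ (_ , e) | inj₂ (_ , e′) = ·-cancelʳ d (trans (sym e) (trans eq e′))
    ... | inj₁ (u≡y , e) | inj₂ (_ , e′) = ⊥-elim (first∉N d∈ (subst (_∈ N) u≡y u∈)
            (subst (_∈ N) (·-cancelʳ d (trans (sym e′) (trans (sym eq) e))) u′∈))
    ... | inj₂ (_ , e) | inj₁ (u′≡y , e′) = ⊥-elim (first∉N d∈ (subst (_∈ N) u′≡y u′∈)
            (subst (_∈ N) (·-cancelʳ d (trans (sym e) (trans eq e′))) u∈))

    -- The quadric d can be recovered from `g d u` as its only divisor of degree 2 outside `Q T`.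
    g-injectiveˡ : ∀ {d d′ u u′} → d ∈ M → d′ ∈ M → u ∈ N → g d u ≡ g d′ u′ → d′ ≡ d
    g-injectiveˡ {d} {d′} {u} {u′} d∈ d′∈ u∈ eq = go (g-shad d∈ u∈ (subst (λ w → d′ ∈ shad w) (sym eq) (d∈g d′ u′)))
      where
      go : d′ ≡ d ⊎ d′ ∈ Q T → d′ ≡ d
      go (inj₁ p) = p
      go (inj₂ p) = ⊥-elim (proj₂ (∈-M⁻ d′∈) p)

    G : List (Mon n)
    G = map (uncurry g) (cartesianProduct M′ N)

    ∈-G⁻ : ∀ {m} → m ∈ G → ∃ λ d → ∃ λ u → d ∈ M′ × u ∈ N × m ≡ g d u
    ∈-G⁻ p with ∈-map⁻ (uncurry g) p
    ... | (d , u) , du∈ , refl with ∈-cartesianProduct⁻ M′ N du∈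
    ...   | d∈ , u∈ = d , u , d∈ , u∈ , refl

    M′⊆M : M′ ⊆ M
    M′⊆M = take-⊆ k M

    T₁ : List (Mon n)
    T₁ = G ++ T₀

    G-unique : Unique G
    G-unique = unique-map-on inj (Unique.cartesianProduct⁺ M′-unique N-unique)
      where
      M′-unique : Unique M′
      M′-unique = Unique.take⁺ k (Unique.filter⁺ (λ d → ¬? (d ∈ₘ? Q T)) (pairs-unique V₀-unique))
      go : ∀ d u d′ u′ → d ∈ M × u ∈ N → d′ ∈ M × u′ ∈ N → g d u ≡ g d′ u′ → d′ ≡ d → (d , u) ≡ (d′ , u′)
      go d u .d u′ (d∈ , u∈) (d′∈ , u′∈) eq refl = cong (d ,_) (g-injectiveʳ d∈ u∈ u′∈ eq)
      mem : ∀ {d u} → (d , u) ∈ cartesianProduct M′ N → d ∈ M × u ∈ N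
      mem p = M′⊆M (proj₁ (∈-cartesianProduct⁻ M′ N p)) , proj₂ (∈-cartesianProduct⁻ M′ N p)
      inj : ∀ {a b} → a ∈ cartesianProduct M′ N → b ∈ cartesianProduct M′ N → uncurry g a ≡ uncurry g b → a ≡ b
      inj {d , u} {d′ , u′} p q eq = go d u d′ u′ (mem p) (mem q) eq
        (g-injectiveˡ {u = u} {u′} (proj₁ (mem p)) (proj₁ (mem q)) (proj₂ (mem p)) eq)

    G-cubic : ∀ {m} → m ∈ G → Cubic m
    G-cubic {m} p = go (∈-G⁻ p)
      where
      go : (∃ λ d → ∃ λ u → d ∈ M′ × u ∈ N × m ≡ g d u) → Cubic m
      go (d , u , d∈ , u∈ , eq) = trans (cong deg eq) (g-cubic u (M′⊆M d∈))

    G-new : ∀ {m} → m ∈ G → m ∉ T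
    G-new {m} p m∈ = go (∈-G⁻ p)
      where
      go : ¬ (∃ λ d → ∃ λ u → d ∈ M′ × u ∈ N × m ≡ g d u)
      go (d , u , d∈ , u∈ , eq) = proj₂ (∈-M⁻ (M′⊆M d∈)) (CQ.∈-collect⁺ m∈ (subst (λ w → d ∈ shad w) (sym eq) (d∈g d u)))

    T₁-cubics : Cubics T₁
    T₁-cubics = Unique.++⁺ G-unique (Unique.filter⁺ (¬? ∘ has-y?) (proj₁ cs)) (λ (p , q) → G-new p (proj₁ (∈-T₀⁻ q)))
              , All.++⁺ (All.tabulate G-cubic) (All.tabulate λ p → All.lookup al (proj₁ (∈-T₀⁻ p)))

    #T₁ : length T ≤ length T₁
    #T₁ = begin
      length T                   ≤⟨ length-filter-split has-y? T (proj₁ cs) ⟩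
      length T₀ + length Tʸ      ≤⟨ +-monoʳ-≤ (length T₀) #Tʸ ⟩
      length T₀ + k * k          ≡⟨ +-comm (length T₀) _ ⟩
      k * k + length T₀          ≡⟨ cong (_+ length T₀) (sym #G) ⟩
      length G + length T₀       ≡⟨ sym (length-++ G) ⟩
      length T₁                  ∎
      where
      open ≤-Reasoning
      #G : length G ≡ k * k
      #G = trans (length-map _ (cartesianProduct M′ N)) (trans (length-cartesianProduct M′ N) (cong (_* k) #M′))

    #Q-T₁ : #Q T₁ ≤ #Q T
    #Q-T₁ = ≤-trans (length-⊆ (Q-unique T₁) sub) (≤-trans (≤-reflexive (trans (length-++ Q₀) (cong (length Q₀ +_) #M′))) #Q₀)
      where
      sub : Q T₁ ⊆ Q₀ ++ M′
      sub {e} p with CQ.∈-collect⁻ T₁ p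
      ... | m , m∈ , e∈ with ∈-++⁻ G m∈
      ...   | inj₂ m∈T₀ = ∈-++⁺ˡ (∈-filter⁺ (¬? ∘ has-y?) (CQ.∈-collect⁺ (proj₁ (∈-T₀⁻ m∈T₀)) e∈)
                λ q → proj₂ (∈-T₀⁻ m∈T₀) (shad-supp e m e∈ q))
      ...   | inj₁ m∈G with ∈-G⁻ m∈G
      ...     | d , u , d∈ , u∈ , eq = go (g-shad (M′⊆M d∈) u∈ e∈g)
        where
        e∈g : e ∈ shad (g d u)
        e∈g = subst (λ w → e ∈ shad w) eq e∈
        go : e ≡ d ⊎ e ∈ Q T → e ∈ Q₀ ++ M′
        go (inj₁ e≡d) = ∈-++⁺ʳ Q₀ (subst (_∈ M′) (sym e≡d) d∈)
        go (inj₂ e∈Q) = ∈-++⁺ˡ (∈-filter⁺ (¬? ∘ has-y?) e∈Q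
          λ q → proj₂ (∈-V₀⁻ (g-supp (M′⊆M d∈) u∈ (shad-supp e (g d u) e∈g q))) refl)

    #V-T₁ : #V T₁ ≡ length V₀
    #V-T₁ = length-≈ (V-unique T₁) V₀-unique to from
      where
      to : V T₁ ⊆ V₀
      to {z} p with CV.∈-collect⁻ T₁ p
      ... | m , m∈ , z∈ with ∈-++⁻ G m∈
      ...   | inj₂ m∈T₀ = ∈-V₀⁺ (CV.∈-collect⁺ (proj₁ (∈-T₀⁻ m∈T₀)) z∈) λ { refl → proj₂ (∈-T₀⁻ m∈T₀) z∈ }
      ...   | inj₁ m∈G with ∈-G⁻ m∈G
      ...     | d , u , d∈ , u∈ , eq = g-supp (M′⊆M d∈) u∈ (subst (λ w → z ∈ supp w) eq z∈)
      g-has : ∀ {z} d → z ≢ y → z ∈ supp (g d z)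
      g-has {z} d z≢y with z Fin.≟ y
      ... | yes eq = ⊥-elim (z≢y eq)
      ... | no _ = ∈-supp⁺ z d
      some-M′ : ∀ {z} → z ∈ N → ∃ λ d → d ∈ M′
      some-M′ p = nonempty (subst (0 <_) (sym #M′) (∈-length p))
      -- A variable z found in a cubic through y is a neighbour of y. Then k is positive, so some
      -- new quadric d exists, and the cubic z d preserves z.
      from : V₀ ⊆ V T₁
      from {z} p with CV.∈-collect⁻ T (proj₁ (∈-V₀⁻ p))
      ... | m , m∈ , z∈ with has-y? m
      ...   | no y∉ = CV.∈-collect⁺ (∈-++⁺ʳ G (∈-filter⁺ (¬? ∘ has-y?) m∈ y∉)) z∈
      ...   | yes y∈ with ∈-N⁺ (pair∈Q al m∈ y∈ z∈ (proj₂ (∈-V₀⁻ p) ∘ sym))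
      ...     | z∈N with some-M′ z∈N
      ...       | d , d∈ = CV.∈-collect⁺ (∈-++⁺ˡ (∈-map⁺ (uncurry g) (∈-cartesianProduct⁺ d∈ z∈N))) (g-has d (proj₂ (∈-V₀⁻ p)))

-- An arbitrary variable y is compressed. If it has not vanished by then, stability allows `Delete`
-- to remove it. Neither step increases the quadrics or loses cubics, so `thin-region` restores the
-- exact values of q and c.
lower-var : ∀ {r q c} → Realizable (suc r) q c → q ≤ c → q ≤ tri r → Realizable r q c
lower-var {r} (realize T cs eqV refl refl) q≤c q≤tri with V T in eqVT | V-unique T
... | y ∷ ys | y∉ ∷ uys = finish (y ∈ᵥ? V C.T′)
  where
  module C = Compressed (compress y T cs (<-wellFounded (weight y T)))
  finish : Dec (y ∈ V C.T′) → Realizable r (#Q T) (length T)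
  finish (no y∉′) = thin-region (realize C.T′ C.cubics #V≡ refl refl) C.#Q≤ q≤c (≤-reflexive (sym C.length≡)) q≤tri
    where
    #V≡ : #V C.T′ ≡ r
    #V≡ = trans (length-≈ (V-unique C.T′) uys to from) (suc-injective eqV)
      where
      to : V C.T′ ⊆ ys
      to {z} p with subst (z ∈_) eqVT (C.V⊆ p)
      ... | here refl = ⊥-elim (y∉′ p)
      ... | there q = q
      from : ys ⊆ V C.T′
      from {z} p = C.V⊇ (λ { refl → All.All¬⇒¬Any y∉ p }) (subst (z ∈_) (sym eqVT) (there p))
  finish (yes y∈′) = thin-region (realize (D.T₁ enough) (D.T₁-cubics enough) (trans (D.#V-T₁ enough) #V₀≡) refl refl)
      (≤-trans (D.#Q-T₁ enough) C.#Q≤) q≤c (≤-trans (≤-reflexive (sym C.length≡)) (D.#T₁ enough)) q≤tri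
    where
    module D = Delete y C.T′ C.cubics y∈′ C.stable
    sameV : #V C.T′ ≡ #V T
    sameV = length-≈ (V-unique C.T′) (V-unique T) C.V⊆ back
      where
      back : V T ⊆ V C.T′
      back {z} p with z Fin.≟ y
      ... | yes refl = y∈′
      ... | no ne = C.V⊇ ne p
    #V₀≡ : length D.V₀ ≡ r
    #V₀≡ = suc-injective (trans D.#V₀ (trans sameV (trans (cong length eqVT) eqV)))
    enough : #Q C.T′ ≤ tri (length D.V₀)
    enough = ≤-trans C.#Q≤ (≤-trans q≤tri (≤-reflexive (cong tri (sym #V₀≡))))

lower-vars : ∀ {r q c} k → Realizable (k + r) q c → q ≤ c → q ≤ tri r → Realizable r q c
lower-vars zero R _ _ = R
lower-vars {r} (suc k) R q≤c q≤tri = lower-vars k (lower-var R q≤c (≤-trans q≤tri (tri-mono (m≤n+m r k)))) q≤c q≤tri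

-- Pure order ideals of socle degree 3 versus families of cubics

∣-refl : (m : Mon n) → m ∣ₘ m
∣-refl m = Pointwise.refl ≤-refl

∣-trans : {l m o : Mon n} → l ∣ₘ m → m ∣ₘ o → l ∣ₘ o
∣-trans = Pointwise.trans ≤-trans

_∣?_ : (d m : Mon n) → Dec (d ∣ₘ m)
_∣?_ = Pointwise.decidable _≤?_

𝟙-∣ : (m : Mon n) → 𝟙 ∣ₘ m
𝟙-∣ [] = []
𝟙-∣ (a ∷ m) = z≤n ∷ 𝟙-∣ m

∣-· : ∀ (x : Fin n) m → m ∣ₘ (x · m)
∣-· zero (a ∷ m) = n≤1+n a ∷ ∣-refl m
∣-· (suc x) (a ∷ m) = ≤-refl ∷ ∣-· x m

·-mono-∣ : ∀ (x : Fin n) {d m} → d ∣ₘ m → (x · d) ∣ₘ (x · m)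
·-mono-∣ zero (p ∷ ps) = s≤s p ∷ ps
·-mono-∣ (suc x) (p ∷ ps) = p ∷ ·-mono-∣ x ps

∣-step : ∀ {d m : Mon n} → d ∣ₘ m → d ≢ m → ∃ λ x → (x · d) ∣ₘ m
∣-step [] ne = ⊥-elim (ne refl)
∣-step {d = a ∷ d} {b ∷ m} (p ∷ ps) ne with a ℕ.≟ b
... | no a≢b = zero , ≤∧≢⇒< p a≢b ∷ ps
... | yes refl with ∣-step ps (ne ∘ cong (a ∷_))
...   | x , q = suc x , p ∷ q

∣-deg : {d m : Mon n} → d ∣ₘ m → deg d ≤ deg m
∣-deg [] = z≤n
∣-deg (p ∷ ps) = +-mono-≤ p (∣-deg ps)

∣-deg-< : {d m : Mon n} → d ∣ₘ m → d ≢ m → deg d < deg m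
∣-deg-< {d = d} {m} p ne with ∣-step p ne
... | x , q = ≤-trans (≤-reflexive (sym (deg-· x d))) (∣-deg q)

∣-deg-≡ : {d m : Mon n} → d ∣ₘ m → deg d ≡ deg m → d ≡ m
∣-deg-≡ {d = d} {m} p eq = decidable-stable (d ≟ₘ m) λ ne → <⇒≢ (∣-deg-< p ne) eq

shad⇒∣ : ∀ {d : Mon n} m → d ∈ shad m → d ∣ₘ m
shad⇒∣ {d = d} m p with ∈-shad⁻ m p
... | x , refl = ∣-· x d

∣⇒shad : ∀ {d m : Mon n} → d ∣ₘ m → deg m ≡ suc (deg d) → d ∈ shad m
∣⇒shad {d = d} {m} p eq with ∣-step p (λ e → 1+n≢n (trans (sym eq) (cong deg (sym e))))
... | x , q = subst (λ w → d ∈ shad w) (∣-deg-≡ q (trans (deg-· x d) (sym eq))) (∈-shad⁺ x d)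

supp⇒∣ : ∀ {x : Fin n} m → x ∈ supp m → (x · 𝟙) ∣ₘ m
supp⇒∣ {x = x} m p with ∈-supp⁻ m p
... | m′ , refl = ·-mono-∣ x (𝟙-∣ m′)

∣⇒supp : ∀ (x : Fin n) {m} → (x · 𝟙) ∣ₘ m → x ∈ supp m
∣⇒supp zero {suc a ∷ m} (s≤s p ∷ ps) = here refl
∣⇒supp (suc x) {zero ∷ m} (p ∷ ps) = ∈-map⁺ suc (∣⇒supp x ps)
∣⇒supp (suc x) {suc a ∷ m} (p ∷ ps) = there (∈-map⁺ suc (∣⇒supp x ps))

-- A crude bound on all degrees in the list, which limits how far `pure-top` has to climb.
sumDeg : List (Mon n) → ℕ
sumDeg [] = 0
sumDeg (m ∷ L) = deg m + sumDeg L

deg≤sumDeg : ∀ {L : List (Mon n)} {m} → m ∈ L → deg m ≤ sumDeg L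
deg≤sumDeg (here refl) = m≤m+n _ _
deg≤sumDeg {L = m ∷ _} (there p) = ≤-trans (deg≤sumDeg p) (m≤n+m _ (deg m))

-- Passing to proper multiples inside `L` raises the degree, which is bounded, so the climb stops at
-- a maximal monomial; purity gives its degree.
pure-top : ∀ {L : List (Mon n)} {e} → IsPure e L → ∀ {m} → m ∈ L → ∃ λ m′ → m′ ∈ L × m ∣ₘ m′ × deg m′ ≡ e
pure-top {L = L} pure {m} m∈ = climb (sumDeg L) m∈ (m≤m+n _ _)
  where
  climb : ∀ f {m} → m ∈ L → sumDeg L ≤ f + deg m → ∃ λ m′ → m′ ∈ L × m ∣ₘ m′ × deg m′ ≡ _
  climb f {m} m∈ le with any? (λ m′ → (m ∣? m′) ×-dec ¬? (m ≟ₘ m′)) L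
  ... | no none = m , m∈ , ∣-refl m , pure m (m∈ , λ {m′} m′∈ m∣m′ →
          sym (decidable-stable (m ≟ₘ m′) λ ne → none (lose m′∈ (m∣m′ , ne))))
  ... | yes some with find some
  climb zero m∈ le | yes some | m′ , m′∈ , p , ne = ⊥-elim (<⇒≱ (∣-deg-< p ne) (≤-trans (deg≤sumDeg m′∈) le))
  climb (suc f) {m} m∈ le | yes some | m′ , m′∈ , p , ne
    with climb f m′∈ (≤-trans le (≤-trans (≤-reflexive (sym (+-suc f (deg m)))) (+-monoʳ-≤ f (∣-deg-< p ne))))
  ... | t , t∈ , q , eq = t , t∈ , ∣-trans p q , eq

ofDeg : ℕ → List (Mon n) → List (Mon n)
ofDeg i = filter (λ m → deg m ℕ.≟ i)

∈-ofDeg⁻ : ∀ {i} (L : List (Mon n)) {m} → m ∈ ofDeg i L → m ∈ L × deg m ≡ i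
∈-ofDeg⁻ {i = i} L = ∈-filter⁻ (λ m → deg m ℕ.≟ i) {xs = L}

∈-ofDeg⁺ : ∀ {i} {L : List (Mon n)} {m} → m ∈ L → deg m ≡ i → m ∈ ofDeg i L
∈-ofDeg⁺ {i = i} = ∈-filter⁺ (λ m → deg m ℕ.≟ i)

-- By purity every monomial of the ideal divides one of its cubics, so the cubics determine the
-- lower degrees: those of degree 2 and 1 are their quadrics and variables.
pure⇒realizable : ∀ {h₀ h₁ h₂ h₃} → S h₀ h₁ h₂ h₃ → Realizable h₁ h₂ h₃ × 0 < h₃
pure⇒realizable {h₁ = h₁} {h₂} {h₃} (n , L , (u , (m₀ , m₀∈) , closed) , pure , h≡) =
  realize T (Unique.filter⁺ _ u , All.tabulate (proj₂ ∘ ∈-ofDeg⁻ L)) (trans #V≡ (sym (h≡ (suc zero))))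
    (trans #Q≡ (sym (h≡ (suc (suc zero))))) (sym (h≡ (suc (suc (suc zero))))) , subst (0 <_) (sym (h≡ (suc (suc (suc zero))))) pos
  where
  T : List (Mon n)
  T = ofDeg 3 L
  top : ∀ {m} → m ∈ L → ∃ λ t → t ∈ T × m ∣ₘ t × deg t ≡ 3
  top p with pure-top pure p
  ... | t , t∈ , q , eq = t , ∈-ofDeg⁺ t∈ eq , q , eq
  pos : 0 < length T
  pos = ∈-length (proj₁ (proj₂ (top m₀∈)))
  #Q≡ : #Q T ≡ count L 2
  #Q≡ = length-≈ (Q-unique T) (Unique.filter⁺ _ u) to from
    where
    to : Q T ⊆ ofDeg 2 L
    to p with CQ.∈-collect⁻ T p
    ... | m , m∈ , d∈ with ∈-ofDeg⁻ L m∈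
    ...   | m∈L , eq = ∈-ofDeg⁺ (closed m∈L (shad⇒∣ m d∈)) (shad-cubic {m = m} eq d∈)
    from : ofDeg 2 L ⊆ Q T
    from p with ∈-ofDeg⁻ L p
    ... | d∈ , eq with top d∈
    ...   | t , t∈ , q , eq′ = CQ.∈-collect⁺ t∈ (∣⇒shad q (trans eq′ (cong suc (sym eq))))
  #V≡ : #V T ≡ count L 1
  #V≡ = trans (sym (length-map (_· 𝟙) (V T)))
    (length-≈ (Unique.map⁺ (λ {x} {y} → ·𝟙-injective x y) (V-unique T)) (Unique.filter⁺ _ u) to from)
    where
    to : map (_· 𝟙) (V T) ⊆ ofDeg 1 L
    to p with ∈-map⁻ (_· 𝟙) p
    ... | x , x∈ , refl with CV.∈-collect⁻ T x∈
    ...   | m , m∈ , x∈m = ∈-ofDeg⁺ (closed (proj₁ (∈-ofDeg⁻ L m∈)) (supp⇒∣ m x∈m)) (trans (deg-· x 𝟙) (cong suc (deg-𝟙 n)))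
    from : ofDeg 1 L ⊆ map (_· 𝟙) (V T)
    from {d} p with ∈-ofDeg⁻ L p
    ... | d∈ , eq with deg-1 d eq
    ...   | x , refl with top d∈
    ...     | t , t∈ , q , _ = ∈-map⁺ (_· 𝟙) (CV.∈-collect⁺ t∈ (∣⇒supp x q))

count-++ : ∀ (L₁ L₂ : List (Mon n)) i → count (L₁ ++ L₂) i ≡ count L₁ i + count L₂ i
count-++ L₁ L₂ i = trans (cong length (filter-++ (λ m → deg m ℕ.≟ i) L₁ L₂)) (length-++ (filter (λ m → deg m ℕ.≟ i) L₁))

count-all : ∀ {L : List (Mon n)} {i} → All (λ m → deg m ≡ i) L → count L i ≡ length L
count-all al = cong length (filter-all _ al)

count-none : ∀ {L : List (Mon n)} {i j} → i ≢ j → All (λ m → deg m ≡ j) L → count L i ≡ 0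
count-none i≢j al = cong length (filter-none _ (All.map (λ eq eq′ → i≢j (trans (sym eq′) eq)) al))

deg-disjoint : ∀ {L₁ L₂ : List (Mon n)} {i} → All (λ m → deg m ≡ i) L₁ → All (λ m → i < deg m) L₂ → ∀ {m} → ¬ (m ∈ L₁ × m ∈ L₂)
deg-disjoint a₁ a₂ (p , q) = <⇒≢ (All.lookup a₂ q) (sym (All.lookup a₁ p))

-- The generated ideal is listed degree by degree. With c > 0 the monomial 1 also divides a cubic,
-- so every maximal element is a cubic.
realizable⇒pure : ∀ {r q c} → Realizable r q c → 0 < c → S 1 r q c
realizable⇒pure (realize {n} T cs@(u , a₃) refl refl refl) 0<c = n , L , (unique , (𝟙 , here refl) , closed) , pure , counts
  where
  X L : List (Mon n)
  X = map (_· 𝟙) (V T)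
  L = [ 𝟙 ] ++ X ++ Q T ++ T
  a₀ : All (λ m → deg m ≡ 0) [ 𝟙 {n} ]
  a₀ = deg-𝟙 n ∷ []
  a₁ : All (λ m → deg m ≡ 1) X
  a₁ = All.map⁺ (All.tabulate λ {x} _ → trans (deg-· x 𝟙) (cong suc (deg-𝟙 n)))
  a₂ : All (λ m → deg m ≡ 2) (Q T)
  a₂ = All.tabulate (Q-quadric a₃)
  above : ∀ {i j} {L : List (Mon n)} → i < j → All (λ m → deg m ≡ j) L → All (λ m → i < deg m) L
  above lt = All.map λ { refl → lt }
  unique : Unique L
  unique = Unique.++⁺ ([] ∷ []) (Unique.++⁺ (Unique.map⁺ (λ {x} {y} → ·𝟙-injective x y) (V-unique T))
      (Unique.++⁺ (Q-unique T) u (deg-disjoint a₂ (above ≤-refl a₃)))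
      (deg-disjoint a₁ (All.++⁺ (above ≤-refl a₂) (above (s≤s (s≤s z≤n)) a₃))))
    (deg-disjoint a₀ (All.++⁺ (above ≤-refl a₁) (All.++⁺ (above (s≤s z≤n) a₂) (above (s≤s z≤n) a₃))))
  ∈-L⁻ : ∀ {m} → m ∈ L → ∃ λ t → t ∈ T × m ∣ₘ t
  ∈-L⁻ (here refl) with nonempty 0<c
  ... | t , t∈ = t , t∈ , 𝟙-∣ t
  ∈-L⁻ (there p) with ∈-++⁻ X p
  ... | inj₁ q with ∈-map⁻ (_· 𝟙) q
  ...   | x , x∈ , refl with CV.∈-collect⁻ T x∈
  ...     | t , t∈ , x∈t = t , t∈ , supp⇒∣ t x∈t
  ∈-L⁻ (there p) | inj₂ q with ∈-++⁻ (Q T) q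
  ... | inj₂ t∈ = _ , t∈ , ∣-refl _
  ... | inj₁ d∈ with CQ.∈-collect⁻ T d∈
  ...   | t , t∈ , d∈t = t , t∈ , shad⇒∣ t d∈t
  T⊆L : T ⊆ L
  T⊆L p = there (∈-++⁺ʳ X (∈-++⁺ʳ (Q T) p))
  ∈-L⁺ : ∀ {t m} → t ∈ T → m ∣ₘ t → m ∈ L
  ∈-L⁺ {t} {m} t∈ p with deg m in eq | ≤-trans (∣-deg p) (≤-reflexive (All.lookup a₃ t∈))
  ... | 0 | _ = here (deg-0 m eq)
  ... | 2 | _ = there (∈-++⁺ʳ X (∈-++⁺ˡ (CQ.∈-collect⁺ t∈ (∣⇒shad p (trans (All.lookup a₃ t∈) (cong suc (sym eq)))))))
  ... | 3 | _ = T⊆L (subst (_∈ T) (sym (∣-deg-≡ p (trans eq (sym (All.lookup a₃ t∈))))) t∈)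
  ... | suc (suc (suc (suc _))) | s≤s (s≤s (s≤s ()))
  ... | 1 | _ with deg-1 m eq
  ...   | x , refl = there (∈-++⁺ˡ (∈-map⁺ (_· 𝟙) (CV.∈-collect⁺ t∈ (∣⇒supp x p))))
  closed : ∀ {m d : Mon n} → m ∈ L → d ∣ₘ m → d ∈ L
  closed m∈ p with ∈-L⁻ m∈
  ... | t , t∈ , q = ∈-L⁺ t∈ (∣-trans p q)
  pure : IsPure 3 L
  pure m (m∈ , maximal) with ∈-L⁻ m∈
  ... | t , t∈ , p = trans (cong deg (sym (maximal (T⊆L t∈) p))) (All.lookup a₃ t∈)
  split : ∀ i → count L i ≡ count [ 𝟙 {n} ] i + (count X i + (count (Q T) i + count T i))
  split i = trans (count-++ [ 𝟙 {n} ] (X ++ Q T ++ T) i) (cong (count [ 𝟙 {n} ] i +_)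
    (trans (count-++ X (Q T ++ T) i) (cong (count X i +_) (count-++ (Q T) T i))))
  by : ∀ {i a b c d} → count [ 𝟙 {n} ] i ≡ a → count X i ≡ b → count (Q T) i ≡ c → count T i ≡ d → count L i ≡ a + (b + (c + d))
  by {i} p q r s = trans (split i) (cong₂ _+_ p (cong₂ _+_ q (cong₂ _+_ r s)))
  counts : ∀ (i : Fin 4) → lookup (1 ∷ #V T ∷ #Q T ∷ length T ∷ []) i ≡ count L (Fin.toℕ i)
  counts zero = sym (by (count-all a₀) (count-none (λ ()) a₁) (count-none (λ ()) a₂) (count-none (λ ()) a₃))
  counts (suc zero) = sym (trans (by (count-none (λ ()) a₀) (trans (count-all a₁) (length-map _ (V T))) (count-none (λ ()) a₂) (count-none (λ ()) a₃)) (+-identityʳ _))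
  counts (suc (suc zero)) = sym (trans (by (count-none (λ ()) a₀) (count-none (λ ()) a₁) (count-all a₂) (count-none (λ ()) a₃)) (+-identityʳ _))
  counts (suc (suc (suc zero))) = sym (by (count-none (λ ()) a₀) (count-none (λ ()) a₁) (count-none (λ ()) a₂) (count-all a₃))

-- Sweeping the three intervals.

realizable-r≤q : ∀ {r q c} → Realizable r q c → r ≤ q
realizable-r≤q (realize T (_ , al) refl refl refl) = #V≤#Q T al

realizable-q≤tri : ∀ {r q c} → Realizable r q c → q ≤ tri r
realizable-q≤tri (realize T (_ , al) refl refl refl) = #Q≤tri T al

-- Both ends matter: one starts the sweep, the other bounds it. For c ≤ q the sweep goes up from r′
-- and r ≤ r″ ≤ q; for q ≤ c it goes down from r″ and q ≤ `tri r′` ≤ `tri r`.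
interval-vars : ∀ {r r′ r″ q c} → Realizable r′ q c → Realizable r″ q c → r′ ≤ r → r ≤ r″ → Realizable r q c
interval-vars {r} {r′} {r″} {q} {c} R′ R″ r′≤r r≤r″ with ≤-total c q
... | inj₁ c≤q = subst (λ z → Realizable z q c) (m∸n+n≡m r′≤r)
  (raise-vars (r ∸ r′) R′ c≤q (≤-trans (≤-reflexive (m∸n+n≡m r′≤r)) (≤-trans r≤r″ (realizable-r≤q R″))))
... | inj₂ q≤c = lower-vars (r″ ∸ r) (subst (λ z → Realizable z q c) (sym (m∸n+n≡m r≤r″)) R″) q≤c
  (≤-trans (realizable-q≤tri R′) (tri-mono r′≤r))

-- The target q decides. For c ≤ q the sweep goes down from q″, with r ≤ q′ ≤ q from the lower end;
-- for q ≤ c it goes up from q′, with q ≤ q″ ≤ `tri r` from the upper end.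
interval-quads : ∀ {r q q′ q″ c} → Realizable r q′ c → Realizable r q″ c → q′ ≤ q → q ≤ q″ → Realizable r q c
interval-quads {q = q} {c = c} R′ R″ q′≤q q≤q″ with ≤-total c q
... | inj₁ c≤q = spread-region R″ ≤-refl c≤q (≤-trans (realizable-r≤q R′) q′≤q) q≤q″
... | inj₂ q≤c = thin-region R′ q′≤q q≤c ≤-refl (≤-trans q≤q″ (realizable-q≤tri R″))

-- Cubics are added to the lower family up to at most q of them, and removed from the upper family
-- down to at least q; the target c lies in one of these two ranges.
interval-cubics : ∀ {r q c c′ c″} → Realizable r q c′ → Realizable r q c″ → c′ ≤ c → c ≤ c″ → Realizable r q c
interval-cubics {q = q} {c} R′ R″ c′≤c c≤c″ with ≤-total c q
... | inj₁ c≤q = spread-region R′ c′≤c c≤q (realizable-r≤q R′) ≤-refl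
... | inj₂ q≤c = thin-region R″ ≤-refl q≤c c≤c″ (realizable-q≤tri R′)

theorem4p3 : (∀ {h₁ h₁′ h₁″ h₂ h₃ : ℕ} → S 1 h₁′ h₂ h₃ → S 1 h₁″ h₂ h₃ →
    h₁′ ≤ h₁ → h₁ ≤ h₁″ → S 1 h₁ h₂ h₃)
    × (∀ {h₁ h₂ h₂′ h₂″ h₃ : ℕ} → S 1 h₁ h₂′ h₃ → S 1 h₁ h₂″ h₃ →
    h₂′ ≤ h₂ → h₂ ≤ h₂″ → S 1 h₁ h₂ h₃)
    × (∀ {h₁ h₂ h₃ h₃′ h₃″ : ℕ} → S 1 h₁ h₂ h₃′ → S 1 h₁ h₂ h₃″ →
    h₃′ ≤ h₃ → h₃ ≤ h₃″ → S 1 h₁ h₂ h₃)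
theorem4p3 =
    (λ s′ s″ p q → let R′ , 0<h₃ = pure⇒realizable s′ ; R″ , _ = pure⇒realizable s″ in
      realizable⇒pure (interval-vars R′ R″ p q) 0<h₃)
  , (λ s′ s″ p q → let R′ , 0<h₃ = pure⇒realizable s′ ; R″ , _ = pure⇒realizable s″ in
      realizable⇒pure (interval-quads R′ R″ p q) 0<h₃)
  , (λ s′ s″ p q → let R′ , 0<h₃′ = pure⇒realizable s′ ; R″ , _ = pure⇒realizable s″ in
      realizable⇒pure (interval-cubics R′ R″ p q) (≤-trans 0<h₃′ p))
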